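{- Let $p$ be an odd prime and $r \ge 1$ an integer. Then \[\Delta^{\ast}(\mathcal{B}_{\pm}(C_p^r)) = \{ \gcd(d_1, \dots, d_r) \colon d_1, \dots, d_r \in \Delta^{\ast}(\mathcal{B}_{\pm}(C_p))\},\] where $C_p$ denotes the cyclic group of order $p$ and $C_p^r$ its $r$-fold direct sum.
   Context: For a subset $G_0$ of an abelian group $G$ (written additively), a sequence over $G_0$ is a finite unordered list $S = g_1 \cdots g_\ell$ of elements of $G_0$ (repetitions allowed), i.e. an element of the free commutative monoid over $G_0$ with concatenation as operation; $|S|=\ell$. $S$ is a plus-minus weighted zero-sum sequence if $\sum_{i} \epsilon_i g_i = 0$ for some $\epsilon_i \in \{+1,-1\}$. $\mathcal{B}_{\pm}(G_0)$ is the monoid of all such sequences. For a monoid $H$ with trivial unit group: atoms are non-identity elements not a product of two non-identity elements; $\mathsf{L}_H(a)$ is the set of all $k$ such that $a$ is a product of $k$ atoms; for finite $L=\{a_0<\dots<a_k\}\subseteq\mathbb{Z}$, $\Delta(L)=\{a_i-a_{i-1}\colon i\in[1,k]\}$; $\Delta(H)=\bigcup_{a\in H}\Delta(\mathsf{L}_H(a))$. A submonoid $S\subseteq H$ is divisor-closed if $s\in S$, $a \in H$ and $a$ divides $s$ in $H$ imply $a\in S$. $\Delta^{\ast}(H)=\{\min\Delta(S)\colon S\subseteq H \text{ divisor-closed submonoid},\ \Delta(S)\neq\emptyset\}$. -}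

module Defs where

open import Data.Nat using (ℕ; zero; suc; _+_; _∸_; _≤_; _<_; NonZero)
open import Data.Nat.DivMod using (_mod_)
open import Data.Nat.GCD using (gcd)
open import Data.Fin using (Fin; toℕ)
open import Data.Bool using (Bool; true; false)
open import Data.List using (List; []; _∷_; _++_; length; concat)
open import Data.List.Relation.Unary.All using (All)
open import Data.List.Relation.Binary.Permutation.Propositional using (_↭_)
open import Data.Vec as V using (Vec; []; _∷_)
open import Data.Product using (Σ; ∃; _×_; _,_)
open import Relation.Binary.PropositionalEquality using (_≡_; _≢_)
open import Relation.Nullary using (¬_)
open import Level using (Level) renaming (suc to lsuc; zero to lzero)

module _ (p : ℕ) .{{_ : NonZero p}} where
  Cp : Set
  Cp = Fin p

  _+p_ : Cp → Cp → Cp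
  a +p b = (toℕ a + toℕ b) mod p

  -p_ : Cp → Cp
  -p a = (p ∸ toℕ a) mod p

  0p : Cp
  0p = 0 mod p

  Cpr : ℕ → Set
  Cpr r = Vec Cp r

  _+pr_ : ∀ {r} → Cpr r → Cpr r → Cpr r
  x +pr y = V.zipWith _+p_ x y

  -pr_ : ∀ {r} → Cpr r → Cpr r
  -pr x = V.map -p_ x

  0pr : ∀ r → Cpr r
  0pr r = V.replicate r 0p

-- Monoid-theoretic notions for a submonoid H of the free commutative
-- monoid F(G) over a type G.  Sequences are lists; equality in F(G) is
-- permutation equivalence _↭_, the operation is concatenation.

module Seqs {G : Set} where

  Seq : Set
  Seq = List G

  DividesIn : (Seq → Set) → Seq → Seq → Set
  DividesIn H a s = Σ Seq λ b → H b × ((a ++ b) ↭ s)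

  DivClosedSubmonoid : (H : Seq → Set) → (S : Seq → Set) → Set
  DivClosedSubmonoid H S =
      (∀ a → S a → H a)
    × S []
    × (∀ a b → S a → S b → S (a ++ b))
    × (∀ s a → S s → H a → DividesIn H a s → S a)

  Atom : (Seq → Set) → Seq → Set
  Atom S a = S a × a ≢ [] ×
    ¬ (Σ Seq λ b → Σ Seq λ c → S b × S c × b ≢ [] × c ≢ [] × (a ↭ (b ++ c)))

  InL : (Seq → Set) → Seq → ℕ → Set
  InL S a k = Σ (List Seq) λ fs → length fs ≡ k × All (Atom S) fs × (concat fs ↭ a)

  InΔ : (Seq → Set) → ℕ → Set
  InΔ S d = Σ Seq λ a → S a × Σ ℕ λ k →
    InL S a k × InL S a (k + d) × 0 < d ×
    (∀ j → k < j → j < k + d → ¬ InL S a j)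

  IsMinΔ : (Seq → Set) → ℕ → Set
  IsMinΔ S d = InΔ S d × (∀ e → InΔ S e → d ≤ e)

  InΔ* : (Seq → Set) → ℕ → Set₁
  InΔ* H d = Σ (Seq → Set) λ S → DivClosedSubmonoid H S × IsMinΔ S d

module PlusMinus {G : Set} (_⊕_ : G → G → G) (⊖_ : G → G) (𝟘 : G) where

  signedSum : (S : List G) → Vec Bool (length S) → G
  signedSum [] [] = 𝟘
  signedSum (g ∷ S) (true ∷ ε) = g ⊕ signedSum S ε
  signedSum (g ∷ S) (false ∷ ε) = (⊖ g) ⊕ signedSum S ε

  B± : List G → Set
  B± S = Σ (Vec Bool (length S)) λ ε → signedSum S ε ≡ 𝟘

B±Cp : (p : ℕ) .{{_ : NonZero p}} → List (Cp p) → Set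
B±Cp p = PlusMinus.B± (_+p_ p) (-p_ p) (0p p)

B±Cpr : (p : ℕ) .{{_ : NonZero p}} (r : ℕ) → List (Cpr p r) → Set
B±Cpr p r = PlusMinus.B± (_+pr_ p) (-pr_ p) (0pr p r)

gcdVec : ∀ {r} → Vec ℕ r → ℕ
gcdVec = V.foldr _ gcd 0

{-# OPTIONS --safe #-}
module Submission where

-- Write 𝓑 for B±(G), |G| odd. Since g² ∈ 𝓑 for all g and T · T = ∏ g² over the letters of T, a
-- divisor-closed submonoid with minimal distance d may be replaced by B±(L), L the support of an
-- element in which d occurs. Length differences of B±(L) form a group generated by min Δ, and
-- A · A = ∏ g² shows that min Δ divides |A| − 2 for each atom A except the letter 0. Conversely, if an odd D
-- divides all |A| − 2, then D divides every length difference, so min Δ(B±(L)) is the gcd of the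
-- numbers |A| − 2; it divides p − 2 because of the atoms g^p.
-- If L is contained in the union of lines ⟨g₁⟩, …, ⟨gₛ⟩ with g₁, …, gₛ independent, every atom
-- lives on one line, and the gcd is that of the lines, each a copy of C_p; this gives "⊇" and most
-- of "⊆". Otherwise choose independent g₁, …, gₛ ∈ L and h = Σ xᵢgᵢ ∈ L with two nonzero
-- coefficients. The atoms h ∏ gᵢ^(bᵢ) with bᵢ ≡ ±xᵢ, and h² ∏ gᵢ^(cᵢ) with cᵢ ≡ ±2xᵢ and some cⱼ
-- odd, force D = 1 when one exponent bᵢ or cᵢ is exchanged for p − bᵢ or p − cᵢ.

open import Defs
open import Data.Bool using (Bool; true; false; not)
import Data.Bool.Properties as Bool
open import Data.Empty using (⊥; ⊥-elim)
open import Data.Fin using (Fin; zero; suc; toℕ; fromℕ<; inject≤; finToFun; funToFin; combine)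
import Data.Fin.Properties as Fin
open import Data.Integer as ℤ using (ℤ; +_; -[1+_]; ∣_∣)
import Data.Integer as Int
open import Data.Integer.Divisibility.Signed using
  (_∣_; divides; ∣ᵤ⇒∣; ∣⇒∣ᵤ; ∣m∣n⇒∣m+n; ∣m∣n⇒∣m-n; ∣m⇒∣-m; ∣m+n∣m⇒∣n; ∣n⇒∣m*n; ∣m⇒∣m*n; _∣?_)
open import Data.Integer.DivMod using (_%ℕ_; _/ℕ_; n%ℕd<d; a≡a%ℕn+[a/ℕn]*n)
import Data.Integer.Properties as ℤ
open import Data.Integer.Tactic.RingSolver using (solve-∀)
open import Data.List using
  (List; []; _∷_; _++_; concat; length; map; replicate; tabulate; take; drop; filter; foldr;
   cartesianProductWith; allFin)
import Data.List.Membership.DecPropositional as DecMembership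
open import Data.List.Membership.Propositional using (_∈_; find)
open import Data.List.Membership.Propositional.Properties using (∈-∃++; ∈-cartesianProductWith⁺; ∈-allFin)
open import Data.List.Properties using
  (length-++; length-map; length-take; length-drop; map-++; concat-++; concat-map; ∷-injective;
   take++drop≡id; filter-accept; ++-identityʳ)
open import Data.List.Relation.Binary.Permutation.Propositional as Perm
  using (_↭_; prep; ↭-refl; ↭-reflexive; ↭-sym; ↭-trans)
open import Data.List.Relation.Binary.Permutation.Propositional.Properties using
  (All-resp-↭; ∈-resp-↭; map⁺; ↭-map-inv; ↭-length; ↭-empty-inv; ↭-singleton-inv; ++⁺; ++⁺ˡ; shift; shifts; filter-↭)
import Data.List.Relation.Binary.Permutation.Propositional.Properties as ↭
open import Data.List.Relation.Unary.All as All using ([]; _∷_) renaming (All to Allₗ)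
import Data.List.Relation.Unary.All.Properties as All
open import Data.List.Relation.Unary.Any as Any using (here; there)
open import Data.Nat as ℕ using (ℕ; zero; suc; _≤_; _<_; z≤n; s≤s; NonZero)
import Data.Nat as Nat
open import Data.Nat.Coprimality as Coprime using (Coprime; coprime-divisor; coprime-Bézout)
import Data.Nat.Divisibility as ℕ
import Data.Nat.DivMod as ℕ
open import Data.Nat.GCD using (gcd; gcd[m,n]∣m; gcd[m,n]∣n; gcd-greatest; gcd-zeroˡ; gcd-GCD; module Bézout)
open import Data.Nat.Induction using (<-rec)
open import Data.Nat.ListAction using (sum)
open import Data.Nat.ListAction.Properties using (sum-++; sum-↭)
open import Data.Nat.Primality using (Prime; euclidsLemma; prime⇒irreducible; prime⇒nonZero; prime⇒nonTrivial)
import Data.Nat.Properties as ℕ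
open import Data.Nat.Tactic.RingSolver renaming (solve-∀ to ℕ-solve-∀)
open import Data.Product using (Σ; ∃₂; _×_; _,_; proj₁; proj₂; map₂)
open import Data.Sum using (_⊎_; inj₁; inj₂)
open import Data.Unit using (⊤; tt)
open import Data.Vec as Vec using (Vec; []; _∷_; lookup)
import Data.Vec.Properties as Vec
open import Data.Vec.Relation.Unary.All using (All)
import Data.Vec.Relation.Unary.All.Properties as VecAll
open import Function using (_∘_)
open import Relation.Binary.PropositionalEquality using
  (_≡_; _≢_; refl; sym; trans; cong; cong₂; subst; subst₂; module ≡-Reasoning)
open import Relation.Nullary using (¬_; Dec; yes; no; contradiction; ¬?; _×-dec_)
open import Relation.Nullary.Decidable using (map′)
open import Relation.Unary using (Decidable)
open import Relation.Unary.Properties using (∁?)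

open import Algebra.Properties.Semiring.Sum ℤ.+-*-semiring using
  (sum-cong-≗; ∑-distrib-+; *-distribˡ-sum) renaming (sum to ∑)

-- Length differences

-- The first exchange alone is inconclusive: from h ∏ gᵢ^(bᵢ) it yields 2xᵢ ≡ p ≡ 2 modulo D, that
-- is xᵢ ≡ 1. The square of h is there because it yields the same for the residue cᵢ of 2xᵢ, while
-- cᵢ is 2xᵢ or 2xᵢ - p, hence ≡ 2 or ≡ 0; so 1 ≡ 2 or 1 ≡ 0. The price of h² is that the sequence
-- might break into two factors with one h each, or shed a factor without h when its two copies
-- cancel. Either would make all exponents even, which is why some cⱼ has to be odd; a second
-- nonzero coefficient lets cᵢ be exchanged while cⱼ stays odd. For "⊆" the minimal distances of the
-- lines must be shown to exist. The list L makes membership decidable, which an arbitrary submonoid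
-- does not offer, and atoms over C_p have length at most p, so each gcd runs over a finite list.
-- The number s of lines is at most r because p^s ≤ p^r; for s < r one line is repeated, which
-- leaves the gcd as it is.

module FactorizationLengths {G : Set} (S : List G → Set)
  (S-[] : S []) (S-++ : ∀ {a b} → S a → S b → S (a ++ b)) (S-↭ : ∀ {a b} → a ↭ b → S a → S b) where
  open Seqs {G}
  open Nat using (_+_; _*_)

  concat∈S : ∀ {fs} → Allₗ (Atom S) fs → S (concat fs)
  concat∈S []       = S-[]
  concat∈S (a ∷ as) = S-++ (proj₁ a) (concat∈S as)

  InL⇒S : ∀ {a k} → InL S a k → S a
  InL⇒S (_ , _ , as , σ) = S-↭ σ (concat∈S as)

  InL-[] : InL S [] 0
  InL-[] = [] , refl , [] , ↭-refl

  InL-++ : ∀ {a b k l} → InL S a k → InL S b l → InL S (a ++ b) (k + l)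
  InL-++ (fs , refl , as , σ) (gs , refl , bs , τ) =
    fs ++ gs , length-++ fs , All.++⁺ as bs ,
    ↭-trans (↭-reflexive (sym (concat-++ fs gs))) (++⁺ σ τ)

  LengthDiff : ℕ → Set
  LengthDiff n = Σ (List G) λ a → Σ ℕ λ k → InL S a k × InL S a (k + n)

  diff-0 : LengthDiff 0
  diff-0 = [] , 0 , InL-[] , InL-[]

  diff-+ : ∀ {m n} → LengthDiff m → LengthDiff n → LengthDiff (m + n)
  diff-+ {m} {n} (a , k , p , q) (b , l , r , s) =
    a ++ b , k + l , InL-++ p r ,
    subst (InL S (a ++ b)) (eq k m l n) (InL-++ q s)
    where
    eq : ∀ k m l n → (k + m) + (l + n) ≡ (k + l) + (m + n)
    eq = ℕ-solve-∀

  diff-* : ∀ x {n} → LengthDiff n → LengthDiff (x * n)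
  diff-* zero    _ = diff-0
  diff-* (suc x) p = diff-+ p (diff-* x p)

  -- In the product of the two elements, the shorter factorization of one is combined with the
  -- longer one of the other.
  diff-∸ : ∀ {d m n} → LengthDiff m → LengthDiff n → d + n ≡ m → LengthDiff d
  diff-∸ {d} {_} {n} (a , k , p , q) (b , l , r , s) refl =
    a ++ b , k + (l + n) , InL-++ p s ,
    subst (InL S (a ++ b)) (eq k d l n) (InL-++ q r)
    where
    eq : ∀ k d l n → (k + (d + n)) + l ≡ (k + (l + n)) + d
    eq = ℕ-solve-∀

  diff-gcd : ∀ {m n} → LengthDiff m → LengthDiff n → LengthDiff (gcd m n)
  diff-gcd {m} {n} p q with Bézout.identity (gcd-GCD m n)
  ... | Bézout.+- x y eq = diff-∸ (diff-* x p) (diff-* y q) eq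
  ... | Bézout.-+ x y eq = diff-∸ (diff-* y q) (diff-* x p) eq

  -- The lengths k and k + n need not be adjacent, so n need not be a distance. If n < d, though, a
  -- length j in between would give the difference j - k < n < d, against the induction hypothesis;
  -- hence n would be a distance below the minimum.
  minΔ≤diff : ∀ {d n} → IsMinΔ S d → LengthDiff n → 0 < n → d ≤ n
  minΔ≤diff {d} {n} (_ , min) = <-rec (λ n → LengthDiff n → 0 < n → d ≤ n) step n
    where
    step : ∀ n → (∀ {m} → m < n → LengthDiff m → 0 < m → d ≤ m) → LengthDiff n → 0 < n → d ≤ n
    step n rec (a , k , p , q) 0<n with d ℕ.≤? n
    ... | yes d≤n = d≤n
    ... | no  d≰n = min n (a , InL⇒S p , k , p , q , 0<n , λ j k<j j<k+n r →
      let j≡   = ℕ.m+[n∸m]≡n (ℕ.<⇒≤ k<j)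
          j∸k<n = ℕ.+-cancelˡ-< k (j ℕ.∸ k) n (subst (_< k + n) (sym j≡) j<k+n)
      in d≰n (ℕ.≤-trans (rec j∸k<n (a , k , p , subst (InL S a) (sym j≡) r) (ℕ.m<n⇒0<n∸m k<j))
                        (ℕ.<⇒≤ j∸k<n)))

  0<minΔ : ∀ {d} → IsMinΔ S d → 0 < d
  0<minΔ ((_ , _ , _ , _ , _ , 0<d , _) , _) = 0<d

  minΔ-diff : ∀ {d} → IsMinΔ S d → LengthDiff d
  minΔ-diff ((a , _ , k , p , q , _) , _) = a , k , p , q

  -- The remainder of n modulo d is a length difference too, and smaller than d.
  minΔ∣diff : ∀ {d n} → IsMinΔ S d → LengthDiff n → d ℕ.∣ n
  minΔ∣diff {suc d-1} {n} isMin p = ℕ.m%n≡0⇒n∣m n d (r≡0 (n ℕ.% d) refl)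
    where
    d = suc d-1
    r-diff : LengthDiff (n ℕ.% d)
    r-diff = diff-∸ p (diff-* (n ℕ./ d) (minΔ-diff isMin)) (sym (ℕ.m≡m%n+[m/n]*n n d))
    r≡0 : ∀ r → n ℕ.% d ≡ r → n ℕ.% d ≡ 0
    r≡0 zero    eq = eq
    r≡0 (suc r) eq = contradiction (minΔ≤diff isMin r-diff (subst (0 <_) (sym eq) (s≤s z≤n)))
                                   (ℕ.<⇒≱ (ℕ.m%n<n n d))
  minΔ∣diff {zero} isMin _ = contradiction (0<minΔ isMin) λ ()

  -- Divisibility of all differences by d leaves no room for a length strictly between k and k + d.
  minΔ-intro : ∀ {d} → 0 < d → LengthDiff d → (∀ {n} → LengthDiff n → d ℕ.∣ n) → IsMinΔ S d
  minΔ-intro {d} 0<d (a , k , p , q) d∣ =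
    (a , InL⇒S p , k , p , q , 0<d , λ j k<j j<k+d r →
      let j≡    = ℕ.m+[n∸m]≡n (ℕ.<⇒≤ k<j)
          j∸k<d = ℕ.+-cancelˡ-< k (j ℕ.∸ k) d (subst (_< k + d) (sym j≡) j<k+d)
          d≤j∸k = ℕ.∣⇒≤ {{ℕ.>-nonZero (ℕ.m<n⇒0<n∸m k<j)}} (d∣ (a , k , p , subst (InL S a) (sym j≡) r))
      in ℕ.<⇒≱ j∸k<d d≤j∸k) ,
    λ e (b , _ , l , r , s , 0<e , _) → ℕ.∣⇒≤ {{ℕ.>-nonZero 0<e}} (d∣ (b , l , r , s))

-- Minimal distances and lengths of atoms

-- B (g ∷ []) encodes g = 0.
record SignedMonoid (G : Set) : Set₁ where
  field
    B      : List G → Set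
    B-[]   : B []
    B-++   : ∀ {a b} → B a → B b → B (a ++ b)
    B-↭    : ∀ {a b} → a ↭ b → B a → B b
    B-pair : ∀ g → B (g ∷ g ∷ [])
    zero?  : ∀ g → Dec (B (g ∷ []))
    B-drop : ∀ {z a} → B (z ∷ []) → B (z ∷ a) → B a

module Arithmetic {G : Set} (M : SignedMonoid G) where
  open SignedMonoid M public
  open Seqs {G} public
  open Nat using (_+_; _*_; _∸_)

  NonzeroLetter : G → Set
  NonzeroLetter g = ¬ B (g ∷ [])

  Over : (G → Set) → List G → Set
  Over Q a = B a × Allₗ Q a

  module Over (Q : G → Set) = FactorizationLengths (Over Q)
    (B-[] , []) (λ (a , p) (b , q) → B-++ a b , All.++⁺ p q) (λ σ (a , p) → B-↭ σ a , All-resp-↭ σ p)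

  atom-over⁺ : ∀ {Q A} → Atom B A → Allₗ Q A → Atom (Over Q) A
  atom-over⁺ (A∈B , A≢[] , ¬split) q =
    (A∈B , q) , A≢[] , λ (b , c , (b∈B , _) , (c∈B , _) , rest) → ¬split (b , c , b∈B , c∈B , rest)

  -- Factors of a sequence over `Q` are again over `Q`, so irreducibility in `Over Q` and in `B`
  -- agree.
  atom-over⁻ : ∀ {Q A} → Atom (Over Q) A → Atom B A × Allₗ Q A
  atom-over⁻ ((A∈B , q) , A≢[] , ¬split) =
    (A∈B , A≢[] , λ (b , c , b∈B , c∈B , b≢ , c≢ , σ) →
      ¬split (b , c , (b∈B , All.++⁻ˡ b (All-resp-↭ σ q)) , (c∈B , All.++⁻ʳ b (All-resp-↭ σ q)) , b≢ , c≢ , σ)) , q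

  -- Zero letters form atoms of length 1; giving them weight 2 makes the weights of
  -- factorizations of length k congruent to 2k modulo D in all cases.
  letterWeight : G → ℕ
  letterWeight g with zero? g
  ... | yes _ = 2
  ... | no  _ = 1

  weight : List G → ℕ
  weight A = sum (map letterWeight A)

  weight-++ : ∀ a b → weight (a ++ b) ≡ weight a + weight b
  weight-++ a b = trans (cong sum (map-++ letterWeight a b)) (sum-++ (map letterWeight a) _)

  weight-↭ : ∀ {a b} → a ↭ b → weight a ≡ weight b
  weight-↭ σ = sum-↭ (map⁺ letterWeight σ)

  weight-zero : ∀ {z} → B (z ∷ []) → weight (z ∷ []) ≡ 2
  weight-zero {z} z∈B with zero? z
  ... | yes _   = refl
  ... | no  z∉B = contradiction z∈B z∉B

  weight-nonzero : ∀ {A} → Allₗ NonzeroLetter A → weight A ≡ length A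
  weight-nonzero []                = refl
  weight-nonzero {g ∷ A} (g∉B ∷ ns) with zero? g
  ... | yes g∈B = contradiction g∈B g∉B
  ... | no  _   = cong suc (weight-nonzero ns)

  ∈⇒↭∷ : ∀ {g : G} {A} → g ∈ A → Σ (List G) λ A′ → A ↭ g ∷ A′
  ∈⇒↭∷ {g} g∈A with ∈-∃++ g∈A
  ... | xs , ys , refl = xs ++ ys , shift g xs ys

  -- By `B-drop` a zero letter can be split off, so an atom containing one consists of it alone.
  atom-cases : ∀ {A} → Atom B A → (Σ G λ z → B (z ∷ []) × A ≡ z ∷ []) ⊎ Allₗ NonzeroLetter A
  atom-cases {A} (A∈B , A≢[] , ¬split) with Any.any? zero? A
  ... | no ¬zero = inj₂ (All.¬Any⇒All¬ A ¬zero)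
  ... | yes hasZero with find hasZero
  ... | z , z∈A , z∈B with ∈⇒↭∷ z∈A
  ... | []     , σ = inj₁ (z , z∈B , ↭-singleton-inv σ)
  ... | x ∷ A′ , σ = contradiction
    (z ∷ [] , x ∷ A′ , z∈B , B-drop z∈B (B-↭ σ A∈B) , (λ ()) , (λ ()) , σ) ¬split

  nonzero-length : ∀ {A} → Atom B A → Allₗ NonzeroLetter A → 2 ≤ length A
  nonzero-length {[]}        (_ , A≢[] , _) _         = contradiction refl A≢[]
  nonzero-length {_ ∷ []}    (A∈B , _)      (g∉B ∷ _) = contradiction A∈B g∉B
  nonzero-length {_ ∷ _ ∷ _} _              _         = s≤s (s≤s z≤n)

  atom-weight≥2 : ∀ {A} → Atom B A → 2 ≤ weight A
  atom-weight≥2 atom with atom-cases atom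
  ... | inj₁ (z , z∈B , refl) = ℕ.≤-reflexive (sym (weight-zero z∈B))
  ... | inj₂ nz               = subst (2 ≤_) (sym (weight-nonzero nz)) (nonzero-length atom nz)

  long-atom-weight : ∀ {A} → Atom B A → 2 ≤ length A → weight A ≡ length A
  long-atom-weight atom 2≤ with atom-cases atom
  ... | inj₁ (z , z∈B , refl) = contradiction 2≤ λ { (s≤s ()) }
  ... | inj₂ nz               = weight-nonzero nz

  pair-atom : ∀ {g} → NonzeroLetter g → Atom B (g ∷ g ∷ [])
  pair-atom {g} g∉B = B-pair g , (λ ()) , split
    where
    g≡ : ∀ {x} → x ∈ g ∷ g ∷ [] → x ≡ g
    g≡ (here eq)         = eq
    g≡ (there (here eq)) = eq
    split : ¬ (Σ (List G) λ b → Σ (List G) λ c → B b × B c × b ≢ [] × c ≢ [] × (g ∷ g ∷ []) ↭ (b ++ c))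
    split ([] , _ , _ , _ , b≢[] , _) = b≢[] refl
    split (x ∷ [] , _ , b∈B , _ , _ , _ , σ) =
      g∉B (subst (λ x → B (x ∷ [])) (g≡ (∈-resp-↭ (↭-sym σ) (here refl))) b∈B)
    split (_ ∷ _ ∷ _ , [] , _ , _ , _ , c≢[] , _) = c≢[] refl
    split (_ ∷ _ ∷ b , _ ∷ _ , _ , _ , _ , _ , σ) =
      impossible b (ℕ.suc-injective (ℕ.suc-injective (↭-length σ)))
      where
      impossible : ∀ b {x c} → 0 ≡ length (b ++ x ∷ c) → ⊥
      impossible []      ()
      impossible (_ ∷ _) ()

  pairs : List G → List (List G)
  pairs = map (λ g → g ∷ g ∷ [])

  concat-pairs : ∀ A → concat (pairs A) ↭ A ++ A
  concat-pairs []      = ↭-refl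
  concat-pairs (g ∷ A) = prep g (↭-trans (prep g (concat-pairs A)) (↭-sym (shift g A A)))

  -- The subtraction is never truncated, see atom-weight≥2.
  AtomsCongruent : (G → Set) → ℕ → Set
  AtomsCongruent Q D = ∀ {A} → Atom B A → Allₗ Q A → D ℕ.∣ weight A ∸ 2

  module _ {Q : G → Set} where
    open Over Q

    -- Every atom has weight ≡ 2 modulo D, so an element with a factorization of length k has weight
    -- ≡ 2k. Two lengths k and k + n of one element therefore give D ∣ 2n, and D is odd.
    congruent⇒∣diff : ∀ {D n} → Coprime D 2 → AtomsCongruent Q D → LengthDiff n → D ℕ.∣ n
    congruent⇒∣diff {D} {n} D⊥2 cong-D (a , k , (fs , refl , as , σ) , (gs , len , bs , τ)) =
      coprime-divisor D⊥2 (ℕ.∣m+n∣m⇒∣n (ℕ.divides (proj₁ (total as)) D∣) (ℕ.n∣m*n (proj₁ (total bs))))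
      where
      total : ∀ {fs} → Allₗ (Atom (Over Q)) fs → Σ ℕ λ x → weight (concat fs) ≡ length fs * 2 + x * D
      total [] = 0 , refl
      total {A ∷ fs} (at ∷ as) with total as | cong-D (proj₁ (atom-over⁻ at)) (proj₂ (atom-over⁻ at))
      ... | x , eq | ℕ.divides q w≡ = q + x , (begin
        weight (A ++ concat fs)                   ≡⟨ weight-++ A _ ⟩
        weight A + weight (concat fs)             ≡⟨ cong₂ _+_ (sym (ℕ.m+[n∸m]≡n (atom-weight≥2 (proj₁ (atom-over⁻ at))))) eq ⟩
        2 + (weight A ∸ 2) + (length fs * 2 + x * D) ≡⟨ cong (λ w → 2 + w + (length fs * 2 + x * D)) w≡ ⟩
        2 + q * D + (length fs * 2 + x * D)       ≡⟨ arith q x D (length fs) ⟩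
        suc (length fs) * 2 + (q + x) * D         ∎)
        where
        open ≡-Reasoning
        arith : ∀ q x D l → 2 + q * D + (l * 2 + x * D) ≡ (1 + l) * 2 + (q + x) * D
        arith = ℕ-solve-∀
      D∣ : proj₁ (total bs) * D + 2 * n ≡ proj₁ (total as) * D
      D∣ = ℕ.+-cancelˡ-≡ (length fs * 2) _ _ (begin
        length fs * 2 + (proj₁ (total bs) * D + 2 * n)   ≡⟨ arith (length fs) n (proj₁ (total bs) * D) ⟩
        (length fs + n) * 2 + proj₁ (total bs) * D       ≡⟨ cong (λ l → l * 2 + proj₁ (total bs) * D) len ⟨
        length gs * 2 + proj₁ (total bs) * D             ≡⟨ proj₂ (total bs) ⟨
        weight (concat gs)                               ≡⟨ weight-↭ (↭-trans τ (↭-sym σ)) ⟩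
        weight (concat fs)                               ≡⟨ proj₂ (total as) ⟩
        length fs * 2 + proj₁ (total as) * D             ∎)
        where
        open ≡-Reasoning
        arith : ∀ l n y → l * 2 + (y + 2 * n) ≡ (l + n) * 2 + y
        arith = ℕ-solve-∀

    -- A · A = ∏ g² has factorizations of lengths 2 and |A|.
    atom-diff : ∀ {A} → Atom B A → Allₗ Q A → LengthDiff (weight A ∸ 2)
    atom-diff {A} atom q with atom-cases atom
    ... | inj₁ (z , z∈B , refl) = subst LengthDiff (cong (_∸ 2) (sym (weight-zero z∈B))) diff-0
    ... | inj₂ nz               = subst (λ w → LengthDiff (w ∸ 2)) (sym (weight-nonzero nz))
      (A ++ A , 2 ,
       (A ∷ A ∷ [] , refl , atom-over⁺ atom q ∷ atom-over⁺ atom q ∷ [] , ++⁺ˡ A (↭.++-identityʳ A)) ,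
       (pairs A , trans (length-map _ A) (sym (ℕ.m+[n∸m]≡n (nonzero-length atom nz))) ,
        All.map⁺ (All.zipWith (λ (n , qg) → atom-over⁺ (pair-atom n) (qg ∷ qg ∷ [])) (nz , q)) ,
        concat-pairs A))

    minΔ⇒congruent : ∀ {d} → IsMinΔ (Over Q) d → AtomsCongruent Q d
    minΔ⇒congruent isMin atom q = minΔ∣diff isMin (atom-diff atom q)

    congruent⇒minΔ : ∀ {d} → 0 < d → Coprime d 2 → LengthDiff d → AtomsCongruent Q d → IsMinΔ (Over Q) d
    congruent⇒minΔ 0<d d⊥2 diff congr = minΔ-intro 0<d diff (congruent⇒∣diff d⊥2 congr)

  over-divClosed : ∀ Q → DivClosedSubmonoid B (Over Q)
  over-divClosed Q =
    (λ _ → proj₁) , (B-[] , []) , (λ _ _ (a , p) (b , q) → B-++ a b , All.++⁺ p q) ,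
    λ s a (_ , q) a∈B (_ , _ , σ) → a∈B , All.++⁻ˡ a (All-resp-↭ (↭-sym σ) q)

  -- A divisor-closed submonoid contains every T ∈ B supported on one of its elements a,
  -- because g² ∣ a² for each letter g of a, and T ∣ T² = ∏ g².
  restrict-to-support : ∀ {S d} → DivClosedSubmonoid B S → IsMinΔ S d →
    Σ (List G) λ L → IsMinΔ (Over (_∈ L)) d
  restrict-to-support {S} {d} (S⊆B , S-[] , S-++ , S-div) ((a , a∈S , k , p , q , 0<d , gap) , min) =
    a , (a , (S⊆B a a∈S , a⊆) , k , toOver a⊆ p , toOver a⊆ q , 0<d , λ j k<j j<k+d r → gap j k<j j<k+d (fromOver r)) ,
    λ e (b , b∈ , l , r , s , 0<e , gap′) →
      min e (b , fromB b∈ , l , fromOver r , fromOver s , 0<e ,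
             λ j l<j j<l+e t → gap′ j l<j j<l+e (toOver (proj₂ b∈) t))
    where
    a⊆ : Allₗ (_∈ a) a
    a⊆ = All.tabulate λ g∈a → g∈a
    -- The cofactor of g² in a² is the square of the remaining letters `a′`, hence a product of
    -- squares and an element of `B`.
    pair∈S : ∀ {g} → g ∈ a → S (g ∷ g ∷ [])
    pair∈S {g} g∈a with ∈⇒↭∷ g∈a
    ... | a′ , σ = S-div (a ++ a) (g ∷ g ∷ []) (S-++ a a a∈S a∈S) (B-pair g)
      (a′ ++ a′ , B-↭ (concat-pairs a′) (pairs∈B a′) ,
       ↭-trans (prep g (↭-sym (shift g a′ a′))) (↭-sym (++⁺ σ σ)))
      where
      pairs∈B : ∀ A → B (concat (pairs A))
      pairs∈B []      = B-[]
      pairs∈B (g ∷ A) = B-++ (B-pair g) (pairs∈B A)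
    pairs∈S : ∀ {A} → Allₗ (_∈ a) A → S (concat (pairs A))
    pairs∈S []         = S-[]
    pairs∈S (g∈ ∷ gs∈) = S-++ _ _ (pair∈S g∈) (pairs∈S gs∈)
    fromB : ∀ {T} → Over (_∈ a) T → S T
    fromB {T} (T∈B , T⊆) = S-div (concat (pairs T)) T (pairs∈S T⊆) T∈B (T , T∈B , ↭-sym (concat-pairs T))
    atom-to : ∀ {T} → Allₗ (_∈ a) T → Atom S T → Atom (Over (_∈ a)) T
    atom-to T⊆ (T∈S , T≢[] , ¬split) = (S⊆B _ T∈S , T⊆) , T≢[] ,
      λ (b , c , b∈ , c∈ , rest) → ¬split (b , c , fromB b∈ , fromB c∈ , rest)
    atom-from : ∀ {T} → Atom (Over (_∈ a)) T → Atom S T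
    atom-from (T∈ , T≢[] , ¬split) = fromB T∈ , T≢[] ,
      λ (b , c , b∈S , c∈S , b≢ , c≢ , σ) → let bc⊆ = All-resp-↭ σ (proj₂ T∈) in
        ¬split (b , c , (S⊆B b b∈S , All.++⁻ˡ b bc⊆) , (S⊆B c c∈S , All.++⁻ʳ b bc⊆) , b≢ , c≢ , σ)
    toOver : ∀ {b k} → Allₗ (_∈ a) b → InL S b k → InL (Over (_∈ a)) b k
    toOver b⊆ (fs , len , as , σ) = fs , len ,
      All.zipWith (λ (T⊆ , at) → atom-to T⊆ at) (All.concat⁻ (All-resp-↭ (↭-sym σ) b⊆) , as) , σ
    fromOver : ∀ {b k} → InL (Over (_∈ a)) b k → InL S b k
    fromOver (fs , len , as , σ) = fs , len , All.map atom-from as , σ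

-- Sums and signed sums

module _ where
  open Int using (_+_; _*_; -_; _-_)

  addˡ : ∀ x {y z} → y ≡ z → x + y ≡ x + z
  addˡ x = cong (λ w → x + w)

  mulˡ : ∀ x {y z} → y ≡ z → x * y ≡ x * z
  mulˡ x = cong (λ w → x * w)

  δℕ : ∀ {n} → Fin n → Fin n → ℕ
  δℕ zero    zero    = 1
  δℕ zero    (suc _) = 0
  δℕ (suc _) zero    = 0
  δℕ (suc i) (suc j) = δℕ i j

  δ : ∀ {n} → Fin n → Fin n → ℤ
  δ i j = + δℕ i j

  δℕ-refl : ∀ {n} (i : Fin n) → δℕ i i ≡ 1
  δℕ-refl zero    = refl
  δℕ-refl (suc i) = δℕ-refl i

  δℕ-≢ : ∀ {n} {i j : Fin n} → i ≢ j → δℕ i j ≡ 0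
  δℕ-≢ {i = zero}  {zero}  i≢j = contradiction refl i≢j
  δℕ-≢ {i = zero}  {suc _} _   = refl
  δℕ-≢ {i = suc _} {zero}  _   = refl
  δℕ-≢ {i = suc _} {suc _} i≢j = δℕ-≢ (i≢j ∘ cong suc)

  δℕ≤1 : ∀ {n} (i j : Fin n) → δℕ i j ≤ 1
  δℕ≤1 zero    zero    = ℕ.≤-refl
  δℕ≤1 zero    (suc _) = z≤n
  δℕ≤1 (suc _) zero    = z≤n
  δℕ≤1 (suc i) (suc j) = δℕ≤1 i j

  ∑-0 : ∀ {n} {f : Fin n → ℤ} → (∀ i → f i ≡ + 0) → ∑ f ≡ + 0
  ∑-0 {zero}  _  = refl
  ∑-0 {suc n} f0 = cong₂ _+_ (f0 zero) (∑-0 (f0 ∘ suc))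

  ∑-δ : ∀ {n} (c : Fin n → ℤ) k → ∑ (λ i → c i * δ i k) ≡ c k
  ∑-δ c zero    = trans (cong₂ _+_ (ℤ.*-identityʳ (c zero)) (∑-0 (λ i → ℤ.*-zeroʳ (c (suc i))))) (ℤ.+-identityʳ _)
  ∑-δ c (suc k) = trans (cong₂ _+_ (ℤ.*-zeroʳ (c zero)) (∑-δ (c ∘ suc) k)) (ℤ.+-identityˡ _)

  ∣-∑ : ∀ {n d} {f : Fin n → ℤ} → (∀ i → d ∣ f i) → d ∣ ∑ f
  ∣-∑ {zero}  _   = divides (+ 0) refl
  ∣-∑ {suc n} d∣f = ∣m∣n⇒∣m+n (d∣f zero) (∣-∑ (d∣f ∘ suc))

  ∣-resp-- : ∀ {d x y} → d ∣ x - y → d ∣ y → d ∣ x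
  ∣-resp-- {d} {x} {y} d∣x-y d∣y = subst (d ∣_) (eq x y) (∣m∣n⇒∣m+n d∣x-y d∣y)
    where
    eq : ∀ x y → x - y + y ≡ x
    eq = solve-∀

  ∣-flip : ∀ {d} x y → d ∣ x - y → d ∣ y - x
  ∣-flip {d} x y d∣ = subst (d ∣_) (eq x y) (∣m⇒∣-m d∣)
    where
    eq : ∀ x y → - (x - y) ≡ y - x
    eq = solve-∀

  signed : Bool → ℤ → ℤ
  signed true  x = x
  signed false x = - x

  -- Signs are stored together with their letters, so that a permutation of the letters carries the
  -- signs along.
  total : ∀ {G : Set} → (G → ℤ) → List (Bool × G) → ℤ
  total f []            = + 0
  total f ((s , g) ∷ T) = signed s (f g) + total f T

  letters : ∀ {G : Set} → List (Bool × G) → List G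
  letters = map proj₂

  module _ {G : Set} where

    total-++ : ∀ (f : G → ℤ) T U → total f (T ++ U) ≡ total f T + total f U
    total-++ f []            U = sym (ℤ.+-identityˡ _)
    total-++ f ((s , g) ∷ T) U = trans (addˡ (signed s (f g)) (total-++ f T U)) (sym (ℤ.+-assoc (signed s (f g)) _ _))

    total-↭ : ∀ (f : G → ℤ) {T U} → T ↭ U → total f T ≡ total f U
    total-↭ f Perm.refl                         = refl
    total-↭ f (Perm.prep (s , g) σ)             = addˡ (signed s (f g)) (total-↭ f σ)
    total-↭ f (Perm.swap {xs} {ys} (s , g) (t , h) σ) =
      trans (cong (λ x → signed s (f g) + (signed t (f h) + x)) (total-↭ f σ))
            (eq (signed s (f g)) (signed t (f h)) (total f ys))
      where
      eq : ∀ x y z → x + (y + z) ≡ y + (x + z)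
      eq = solve-∀
    total-↭ f (Perm.trans σ τ)                  = trans (total-↭ f σ) (total-↭ f τ)

    total-0 : ∀ T → total {G} (λ _ → + 0) T ≡ + 0
    total-0 []              = refl
    total-0 ((true , _) ∷ T) = trans (ℤ.+-identityˡ _) (total-0 T)
    total-0 ((false , _) ∷ T) = trans (ℤ.+-identityˡ _) (total-0 T)

    total-+ : ∀ (f h : G → ℤ) T → total (λ g → f g + h g) T ≡ total f T + total h T
    total-+ f h []                = refl
    total-+ f h ((true , g) ∷ T)  = trans (addˡ (f g + h g) (total-+ f h T)) (eq (f g) (h g) _ _)
      where
      eq : ∀ a b x y → a + b + (x + y) ≡ a + x + (b + y)
      eq = solve-∀
    total-+ f h ((false , g) ∷ T) = trans (addˡ (- (f g + h g)) (total-+ f h T)) (eq (f g) (h g) _ _)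
      where
      eq : ∀ a b x y → - (a + b) + (x + y) ≡ - a + x + (- b + y)
      eq = solve-∀

    total-*ʳ : ∀ (f : G → ℤ) c T → total (λ g → f g * c) T ≡ total f T * c
    total-*ʳ f c []                = refl
    total-*ʳ f c ((true , g) ∷ T)  = trans (addˡ (f g * c) (total-*ʳ f c T)) (sym (ℤ.*-distribʳ-+ c (f g) _))
    total-*ʳ f c ((false , g) ∷ T) = trans (addˡ (- (f g * c)) (total-*ʳ f c T)) (eq (f g) c _)
      where
      eq : ∀ a c x → - (a * c) + x * c ≡ (- a + x) * c
      eq = solve-∀

    total-∑ : ∀ {n} (F : G → Fin n → ℤ) T → total (λ g → ∑ (F g)) T ≡ ∑ (λ i → total (λ g → F g i) T)
    total-∑ {zero}  F T = total-0 T
    total-∑ {suc n} F T = trans (total-+ (λ g → F g zero) (λ g → ∑ (F g ∘ suc)) T)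
                                (addˡ (total (λ g → F g zero) T) (total-∑ (λ g → F g ∘ suc) T))

    total-∣ : ∀ {d} (f : G → ℤ) → (∀ g → d ∣ f g) → ∀ T → d ∣ total f T
    total-∣ f d∣f []                = divides (+ 0) refl
    total-∣ f d∣f ((true , g) ∷ T)  = ∣m∣n⇒∣m+n (d∣f g) (total-∣ f d∣f T)
    total-∣ f d∣f ((false , g) ∷ T) = ∣m∣n⇒∣m+n (∣m⇒∣-m (d∣f g)) (total-∣ f d∣f T)

    total-mod : ∀ {d} (f h : G → ℤ) → (∀ g → d ∣ f g - h g) → ∀ T → d ∣ total f T - total h T
    total-mod {d} f h d∣ T = subst (d ∣_) eq (total-∣ (λ g → f g - h g) d∣ T)
      where
      open ≡-Reasoning
      neg : ∀ T → total (λ g → - h g) T ≡ - total h T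
      neg []                = refl
      neg ((true , g) ∷ T)  = trans (addˡ (- h g) (neg T)) (sym (ℤ.neg-distrib-+ (h g) _))
      neg ((false , g) ∷ T) = trans (addˡ (- - h g) (neg T)) (sym (ℤ.neg-distrib-+ (- h g) _))
      eq : total (λ g → f g - h g) T ≡ total f T - total h T
      eq = trans (total-+ f (λ g → - h g) T) (addˡ (total f T) (neg T))

  total-map : ∀ {K G : Set} (f : G → ℤ) (γ : K → G) T → total f (map (map₂ γ) T) ≡ total (f ∘ γ) T
  total-map f γ []      = refl
  total-map f γ (x ∷ T) = addˡ (signed (proj₁ x) (f (γ (proj₂ x)))) (total-map f γ T)

  letters-map : ∀ {K G : Set} (γ : K → G) T → letters (map (map₂ γ) T) ≡ map γ (letters T)
  letters-map γ []      = refl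
  letters-map γ (x ∷ T) = cong (γ (proj₂ x) ∷_) (letters-map γ T)

  letters≡map : ∀ {K G : Set} (γ : K → G) S T → letters T ≡ map γ S →
    Σ (List (Bool × K)) λ U → letters U ≡ S × T ≡ map (map₂ γ) U
  letters≡map γ []      []            _  = [] , refl , refl
  letters≡map γ (k ∷ S) ((s , g) ∷ T) eq with ∷-injective eq
  ... | refl , eq′ with letters≡map γ S T eq′
  ... | U , refl , refl = (s , k) ∷ U , refl , refl

-- Zero-sum sequences modulo p

module ZeroSums (p : ℕ) {G : Set} {r : ℕ} (val : G → Fin r → ℤ) where
  open Int using (_+_; _*_; -_; _-_)

  coord : Fin r → List (Bool × G) → ℤ
  coord j = total (λ g → val g j)

  -- `G` is a bare alphabet whose integer coordinates `val` matter only modulo p. Index types can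
  -- thus stand in for group elements, with a map `γ` translating between the two.
  ZeroSum : List G → Set
  ZeroSum S = Σ (List (Bool × G)) λ T → letters T ≡ S × ∀ j → + p ∣ coord j T

  zero-letter⁻ : ∀ {z} → ZeroSum (z ∷ []) → ∀ j → + p ∣ val z j
  zero-letter⁻ ((true , z) ∷ [] , refl , p∣) j = subst (+ p ∣_) (ℤ.+-identityʳ _) (p∣ j)
  zero-letter⁻ ((false , z) ∷ [] , refl , p∣) j =
    subst (+ p ∣_) (trans (cong -_ (ℤ.+-identityʳ _)) (ℤ.neg-involutive _)) (∣m⇒∣-m (p∣ j))

  zero-letter⁺ : ∀ {z} → (∀ j → + p ∣ val z j) → ZeroSum (z ∷ [])
  zero-letter⁺ {z} p∣ = (true , z) ∷ [] , refl , λ j → subst (+ p ∣_) (sym (ℤ.+-identityʳ _)) (p∣ j)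

  zeroSums : SignedMonoid G
  zeroSums = record
    { B      = ZeroSum
    ; B-[]   = [] , refl , λ _ → divides (+ 0) refl
    ; B-++   = λ { (T , refl , p∣T) (U , refl , p∣U) → T ++ U , map-++ proj₂ T U ,
                   λ j → subst (+ p ∣_) (sym (total-++ _ T U)) (∣m∣n⇒∣m+n (p∣T j) (p∣U j)) }
    ; B-↭    = λ { σ (T , refl , p∣T) → let U , eq , τ = ↭-map-inv proj₂ σ in
                   U , sym eq , λ j → subst (+ p ∣_) (total-↭ _ τ) (p∣T j) }
    ; B-pair = λ g → (true , g) ∷ (false , g) ∷ [] , refl , λ j → divides (+ 0) (cancel (val g j))
    ; zero?  = λ g → map′ zero-letter⁺ zero-letter⁻ (Fin.all? λ j → + p ∣? val g j)
    ; B-drop = drop-zero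
    }
    where
    cancel : ∀ x → x + (- x + + 0) ≡ + 0
    cancel = solve-∀
    drop-zero : ∀ {z a} → ZeroSum (z ∷ []) → ZeroSum (z ∷ a) → ZeroSum a
    drop-zero z∈ ((true  , z) ∷ T , refl , p∣) = T , refl , λ j → ∣m+n∣m⇒∣n (p∣ j) (zero-letter⁻ z∈ j)
    drop-zero z∈ ((false , z) ∷ T , refl , p∣) = T , refl , λ j → ∣m+n∣m⇒∣n (p∣ j) (∣m⇒∣-m (zero-letter⁻ z∈ j))

-- Transfer of atoms along maps of letters

Independent : ℕ → ∀ {s r} → (Fin s → Fin r → ℤ) → Set
Independent p {s} M = ∀ (c : Fin s → ℤ) → (∀ j → + p ∣ ∑ (λ i → c i Int.* M i j)) → ∀ i → + p ∣ c i

module Embedding {K G : Set} (M′ : SignedMonoid K) (M : SignedMonoid G) (γ : K → G)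
  (B-map : ∀ {T} → SignedMonoid.B M′ T → SignedMonoid.B M (map γ T))
  (B-unmap : ∀ {T} → SignedMonoid.B M (map γ T) → SignedMonoid.B M′ T) where
  open Arithmetic M
  module K = Arithmetic M′

  map≡++ : ∀ b {c} T → b ++ c ≡ map γ T → ∃₂ λ b′ c′ → T ≡ b′ ++ c′ × b ≡ map γ b′ × c ≡ map γ c′
  map≡++ []      T       eq = [] , T , refl , refl , eq
  map≡++ (x ∷ b) (k ∷ T) eq with ∷-injective eq
  ... | x≡ , eq′ with map≡++ b T eq′
  ... | b′ , c′ , refl , refl , refl = k ∷ b′ , c′ , refl , cong (_∷ map γ b′) x≡ , refl

  -- A splitting of `map γ T` is lifted through the permutation itself, which traces the letters of
  -- `T` even where `γ` identifies some of them.
  atom-map : ∀ {T} → K.Atom K.B T → Atom B (map γ T)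
  atom-map {T} (T∈B , T≢[] , ¬split) = B-map T∈B , ≢[] T T≢[] , split
    where
    ≢[] : ∀ T → T ≢ [] → map γ T ≢ []
    ≢[] []      T≢[] _ = T≢[] refl
    ≢[] (_ ∷ _) _    ()
    split : ¬ (Σ (List G) λ b → Σ (List G) λ c → B b × B c × b ≢ [] × c ≢ [] × map γ T ↭ (b ++ c))
    split (b , c , b∈B , c∈B , b≢[] , c≢[] , σ) with ↭-map-inv γ σ
    ... | U , eq , τ with map≡++ b U eq
    ... | b′ , c′ , refl , refl , refl = ¬split
      (b′ , c′ , B-unmap b∈B , B-unmap c∈B , (λ { refl → b≢[] refl }) , (λ { refl → c≢[] refl }) , τ)

  atom-unmap : ∀ {T} → Atom B (map γ T) → K.Atom K.B T
  atom-unmap {T} (T∈B , T≢[] , ¬split) = B-unmap T∈B , (λ { refl → T≢[] refl }) ,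
    λ { (b , c , b∈B , c∈B , b≢[] , c≢[] , σ) → ¬split
      (map γ b , map γ c , B-map b∈B , B-map c∈B , ≢[] b b≢[] , ≢[] c c≢[] ,
       ↭-trans (map⁺ γ σ) (↭-reflexive (map-++ γ b c))) }
    where
    ≢[] : ∀ T → T ≢ [] → map γ T ≢ []
    ≢[] []      T≢[] _ = T≢[] refl
    ≢[] (_ ∷ _) _    ()

  letterWeight-map : ∀ k → letterWeight (γ k) ≡ K.letterWeight k
  letterWeight-map k with zero? (γ k) | K.zero? k
  ... | yes _   | yes _   = refl
  ... | no  _   | no  _   = refl
  ... | yes γk∈ | no  k∉  = contradiction (B-unmap γk∈) k∉
  ... | no  γk∉ | yes k∈  = contradiction (B-map k∈) γk∉

  weight-map : ∀ T → weight (map γ T) ≡ K.weight T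
  weight-map []      = refl
  weight-map (k ∷ T) = cong₂ Nat._+_ (letterWeight-map k) (weight-map T)

  module _ {Q′ : K → Set} {Q : G → Set} (Q-map : ∀ {k} → Q′ k → Q (γ k)) where

    congruent-pullback : ∀ {D} → AtomsCongruent Q D → K.AtomsCongruent Q′ D
    congruent-pullback congr {T} atom q =
      subst (λ w → _ ℕ.∣ w Nat.∸ 2) (weight-map T) (congr (atom-map atom) (All.map⁺ (All.map Q-map q)))

    InL-map : ∀ {a k} → K.InL (K.Over Q′) a k → InL (Over Q) (map γ a) k
    InL-map (fs , len , as , σ) = map (map γ) fs , trans (length-map _ fs) len ,
      All.map⁺ (All.map (λ at → let at′ , q = K.atom-over⁻ at in
        atom-over⁺ (atom-map at′) (All.map⁺ (All.map Q-map q))) as) ,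
      ↭-trans (↭-reflexive (concat-map fs)) (map⁺ γ σ)

    diff-map : ∀ {n} → K.Over.LengthDiff Q′ n → Over.LengthDiff Q n
    diff-map (a , k , p , q) = map γ a , k , InL-map p , InL-map q

module Coordinates (p : ℕ) {K G : Set} {s r : ℕ} (val′ : K → Fin s → ℤ) (val : G → Fin r → ℤ) (γ : K → G)
  (M : Fin s → Fin r → ℤ) (indep : Independent p M)
  (rep : ∀ k j → + p ∣ val (γ k) j ℤ.- ∑ (λ i → val′ k i ℤ.* M i j)) where
  open Int using (_+_; _*_; -_; _-_)
  private
    module K = ZeroSums p val′
    module G = ZeroSums p val

  coord-map : ∀ T j → + p ∣ G.coord j (map (map₂ γ) T) - ∑ (λ i → K.coord i T * M i j)
  coord-map T j = subst₂ (λ x y → + p ∣ x - y)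
    (sym (total-map _ γ T))
    (trans (total-∑ (λ k i → val′ k i * M i j) T) (sum-cong-≗ λ i → total-*ʳ (λ k → val′ k i) (M i j) T))
    (total-mod _ _ (λ k → rep k j) T)

  zeroSum-map : ∀ {S} → K.ZeroSum S → G.ZeroSum (map γ S)
  zeroSum-map (T , refl , p∣) = map (map₂ γ) T , letters-map γ T , λ j →
    ∣-resp-- (coord-map T j) (∣-∑ λ i → ∣m⇒∣m*n (M i j) (p∣ i))

  -- Here independence enters: the coordinates of the image are, modulo p, a combination of the
  -- elements `M i`, and it vanishes only if all its coefficients do.
  zeroSum-unmap : ∀ {S} → G.ZeroSum (map γ S) → K.ZeroSum S
  zeroSum-unmap {S} (T , eq , p∣) with letters≡map γ S T eq
  ... | U , refl , refl = U , refl , indep (λ i → K.coord i U) λ j →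
    ∣-resp-- (∣-flip _ (∑ (λ i → K.coord i U * M i j)) (coord-map U j)) (p∣ j)

  open Embedding K.zeroSums G.zeroSums γ zeroSum-map zeroSum-unmap public

-- Unsigned sums, parity and size

module _ where
  open Int using (_+_; _*_; -_; _-_)

  sumᶻ : ∀ {K : Set} → (K → ℤ) → List K → ℤ
  sumᶻ F []      = + 0
  sumᶻ F (k ∷ S) = F k + sumᶻ F S

  signed-abs : ∀ s n → ∣ signed s (+ n) ∣ ≡ n
  signed-abs true  n = refl
  signed-abs false n = ℤ.∣-i∣≡∣i∣ (+ n)

  module _ {K : Set} where

    sumᶻ-++ : ∀ (F : K → ℤ) S T → sumᶻ F (S ++ T) ≡ sumᶻ F S + sumᶻ F T
    sumᶻ-++ F []      T = sym (ℤ.+-identityˡ _)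
    sumᶻ-++ F (k ∷ S) T = trans (addˡ (F k) (sumᶻ-++ F S T)) (sym (ℤ.+-assoc (F k) _ _))

    sumᶻ-replicate : ∀ (F : K → ℤ) n k → sumᶻ F (replicate n k) ≡ + n * F k
    sumᶻ-replicate F zero    k = refl
    sumᶻ-replicate F (suc n) k = trans (addˡ (F k) (sumᶻ-replicate F n k)) (eq (F k) (+ n))
      where
      eq : ∀ x n → x + n * x ≡ (+ 1 + n) * x
      eq = solve-∀

    sumᶻ-concat : ∀ (F : K → ℤ) {n} (Ss : Fin n → List K) →
      sumᶻ F (concat (tabulate Ss)) ≡ ∑ (λ i → sumᶻ F (Ss i))
    sumᶻ-concat F {zero}  Ss = refl
    sumᶻ-concat F {suc n} Ss = trans (sumᶻ-++ F (Ss zero) _) (addˡ (sumᶻ F (Ss zero)) (sumᶻ-concat F (Ss ∘ suc)))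

    sumᶻ-+sum : ∀ (f : K → ℕ) S → sumᶻ (+_ ∘ f) S ≡ + sum (map f S)
    sumᶻ-+sum f []      = refl
    sumᶻ-+sum f (k ∷ S) = addˡ (+ f k) (sumᶻ-+sum f S)

    sumᶻ-length : ∀ S → sumᶻ {K} (λ _ → + 1) S ≡ + length S
    sumᶻ-length []      = refl
    sumᶻ-length (k ∷ S) = addˡ (+ 1) (sumᶻ-length S)

    total-label : ∀ (f : K → ℤ) (sg : K → Bool) S →
      total f (map (λ k → sg k , k) S) ≡ sumᶻ (λ k → signed (sg k) (f k)) S
    total-label f sg []      = refl
    total-label f sg (k ∷ S) = addˡ (signed (sg k) (f k)) (total-label f sg S)

    letters-label : ∀ (sg : K → Bool) S → letters (map (λ k → sg k , k) S) ≡ S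
    letters-label sg []      = refl
    letters-label sg (k ∷ S) = cong (k ∷_) (letters-label sg S)

    ∣total∣≤ : ∀ (f : K → ℕ) T → ∣ total (+_ ∘ f) T ∣ ≤ sum (map f (letters T))
    ∣total∣≤ f []            = z≤n
    ∣total∣≤ f ((s , k) ∷ T) = ℕ.≤-trans (ℤ.∣i+j∣≤∣i∣+∣j∣ (signed s (+ f k)) _)
      (ℕ.+-mono-≤ (ℕ.≤-reflexive (signed-abs s (f k))) (∣total∣≤ f T))

    -- Flipping the sign of a letter changes the sum by twice its value.
    total-parity : ∀ (f : K → ℕ) T → + 2 ∣ total (+_ ∘ f) T - + sum (map f (letters T))
    total-parity f []                = divides (+ 0) refl
    total-parity f ((true , k) ∷ T)  = subst (+ 2 ∣_) (eq (+ f k) (total (+_ ∘ f) T) (+ sum (map f (letters T)))) (total-parity f T)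
      where
      eq : ∀ x t y → t - y ≡ x + t - (x + y)
      eq = solve-∀
    total-parity f ((false , k) ∷ T) = subst (+ 2 ∣_) (eq (+ f k) (total (+_ ∘ f) T) (+ sum (map f (letters T))))
      (∣m∣n⇒∣m-n (total-parity f T) (∣m⇒∣m*n {+ 2} {+ 2} (+ f k) (divides (+ 1) refl)))
      where
      eq : ∀ x t y → t - y - + 2 * x ≡ - x + t - (x + y)
      eq = solve-∀

  ∣-small⇒0 : ∀ {p v} → + p ∣ v → ∣ v ∣ < p → v ≡ + 0
  ∣-small⇒0 {p} {v} p∣v v<p = ℤ.∣i∣≡0⇒i≡0 (small ∣ v ∣ (∣⇒∣ᵤ p∣v) v<p)
    where
    small : ∀ n → p ℕ.∣ n → n < p → n ≡ 0
    small zero    _   _   = refl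
    small (suc n) p∣n n<p = contradiction (ℕ.∣⇒≤ p∣n) (ℕ.<⇒≱ n<p)

  2∣signed- : ∀ s n → + 2 ∣ signed s (+ n) - + n
  2∣signed- true  n = divides (+ 0) (ℤ.+-inverseʳ (+ n))
  2∣signed- false n = divides (- + n) (eq (+ n))
    where
    eq : ∀ x → - x - x ≡ - x * + 2
    eq = solve-∀

-- Atoms h^m ∏ gᵢ^(bᵢ)

-- The letter zero stands for an element h, and suc i for the i-th of s independent
-- elements gᵢ; coordinates are taken with respect to the gᵢ, so h has coordinates x.
module PowerSequences (p : ℕ) (p⊥2 : Coprime p 2) {s : ℕ} (x : Fin s → ℤ) where
  open Int using (_+_; _*_; -_; _-_)

  isHead : Fin (suc s) → ℕ
  isHead zero    = 1
  isHead (suc _) = 0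

  isBase : Fin s → Fin (suc s) → ℕ
  isBase i zero    = 0
  isBase i (suc k) = δℕ i k

  val : Fin (suc s) → Fin s → ℤ
  val k i = + isHead k * x i + + isBase i k

  open ZeroSums p val
  open Arithmetic zeroSums

  heads : List (Fin (suc s)) → ℕ
  heads S = sum (map isHead S)

  bases : Fin s → List (Fin (suc s)) → ℕ
  bases i S = sum (map (isBase i) S)

  signedHeads : List (Bool × Fin (suc s)) → ℤ
  signedHeads = total (+_ ∘ isHead)

  signedBases : Fin s → List (Bool × Fin (suc s)) → ℤ
  signedBases i = total (+_ ∘ isBase i)

  coord≡ : ∀ i T → coord i T ≡ signedHeads T * x i + signedBases i T
  coord≡ i T = trans (total-+ (λ k → + isHead k * x i) (+_ ∘ isBase i) T)
                     (cong₂ _+_ (total-*ʳ (+_ ∘ isHead) (x i) T) refl)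

  powers : ℕ → (Fin s → ℕ) → List (Fin (suc s))
  powers m b = replicate m zero ++ concat (tabulate λ i → replicate (b i) (suc i))

  sumᶻ-powers : ∀ F m b → sumᶻ F (powers m b) ≡ + m * F zero + ∑ (λ i → + b i * F (suc i))
  sumᶻ-powers F m b = trans (sumᶻ-++ F (replicate m zero) _)
    (cong₂ _+_ (sumᶻ-replicate F m zero)
      (trans (sumᶻ-concat F (λ i → replicate (b i) (suc i))) (sum-cong-≗ λ i → sumᶻ-replicate F (b i) (suc i))))

  heads-powers : ∀ m b → heads (powers m b) ≡ m
  heads-powers m b = ℤ.+-injective (begin
    + heads (powers m b)                       ≡⟨ sumᶻ-+sum isHead (powers m b) ⟨
    sumᶻ (+_ ∘ isHead) (powers m b)            ≡⟨ sumᶻ-powers (+_ ∘ isHead) m b ⟩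
    + m * + 1 + ∑ (λ i → + b i * + 0)          ≡⟨ cong₂ _+_ (ℤ.*-identityʳ (+ m)) (∑-0 λ i → ℤ.*-zeroʳ (+ b i)) ⟩
    + m + + 0                                  ≡⟨ ℤ.+-identityʳ (+ m) ⟩
    + m                                        ∎)
    where open ≡-Reasoning

  δ-comm : ∀ {n} (i k : Fin n) → δ i k ≡ δ k i
  δ-comm zero    zero    = refl
  δ-comm zero    (suc _) = refl
  δ-comm (suc _) zero    = refl
  δ-comm (suc i) (suc k) = δ-comm i k

  bases-powers : ∀ k m b → bases k (powers m b) ≡ b k
  bases-powers k m b = ℤ.+-injective (begin
    + bases k (powers m b)                     ≡⟨ sumᶻ-+sum (isBase k) (powers m b) ⟨
    sumᶻ (+_ ∘ isBase k) (powers m b)          ≡⟨ sumᶻ-powers (+_ ∘ isBase k) m b ⟩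
    + m * + 0 + ∑ (λ i → + b i * δ k i)        ≡⟨ cong₂ _+_ (ℤ.*-zeroʳ (+ m)) (sum-cong-≗ λ i → mulˡ (+ b i) (δ-comm k i)) ⟩
    + 0 + ∑ (λ i → + b i * δ i k)              ≡⟨ trans (ℤ.+-identityˡ _) (∑-δ (+_ ∘ b) k) ⟩
    + b k                                      ∎)
    where open ≡-Reasoning

  length-powers : ∀ m b → + length (powers m b) ≡ + m + ∑ (+_ ∘ b)
  length-powers m b = begin
    + length (powers m b)                      ≡⟨ sumᶻ-length (powers m b) ⟨
    sumᶻ (λ _ → + 1) (powers m b)              ≡⟨ sumᶻ-powers (λ _ → + 1) m b ⟩
    + m * + 1 + ∑ (λ i → + b i * + 1)          ≡⟨ cong₂ _+_ (ℤ.*-identityʳ (+ m)) (sum-cong-≗ λ i → ℤ.*-identityʳ (+ b i)) ⟩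
    + m + ∑ (+_ ∘ b)                           ∎
    where open ≡-Reasoning

  heads+bases≤length : ∀ i S → heads S Nat.+ bases i S ≤ length S
  heads+bases≤length i []          = z≤n
  heads+bases≤length i (zero  ∷ S) = s≤s (heads+bases≤length i S)
  heads+bases≤length i (suc k ∷ S) = begin
    heads S Nat.+ (δℕ i k Nat.+ bases i S) ≡⟨ eq (heads S) (δℕ i k) (bases i S) ⟩
    δℕ i k Nat.+ (heads S Nat.+ bases i S) ≤⟨ ℕ.+-mono-≤ (δℕ≤1 i k) (heads+bases≤length i S) ⟩
    suc (length S)                         ∎
    where
    open ℕ.≤-Reasoning
    eq : ∀ a b c → a Nat.+ (b Nat.+ c) ≡ b Nat.+ (a Nat.+ c)
    eq = ℕ-solve-∀

  headless-baseless⇒[] : ∀ S → heads S ≡ 0 → (∀ i → bases i S ≡ 0) → S ≡ []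
  headless-baseless⇒[] []          _  _  = refl
  headless-baseless⇒[] (zero ∷ S)  ()
  headless-baseless⇒[] (suc k ∷ S) _  b0 with trans (cong (Nat._+ bases k S) (sym (δℕ-refl k))) (b0 k)
  ... | ()

  Zero : List (Bool × Fin (suc s)) → Set
  Zero T = ∀ i → + p ∣ coord i T

  module _ {T : List (Bool × Fin (suc s))} (T-zero : Zero T) where

    zero-coord : ∀ {z} → signedHeads T ≡ z → ∀ i → + p ∣ z * x i + signedBases i T
    zero-coord refl i = subst (+ p ∣_) (coord≡ i T) (T-zero i)

    -- If the copies of h cancel, the i-th coordinate is the signed number of letters gᵢ. It is
    -- divisible by p and smaller than p in absolute value, hence 0, and a signed count can be 0
    -- only for an even number of letters.
    balanced-even : ∀ {i} → signedHeads T ≡ + 0 → bases i (letters T) < p → + 2 ∣ + bases i (letters T)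
    balanced-even {i} h0 b<p =
      ∣-resp-- (∣-flip (signedBases i T) _ (total-parity (isBase i) T))
               (subst (+ 2 ∣_) (sym B≡0) (divides (+ 0) refl))
      where
      B≡0 : signedBases i T ≡ + 0
      B≡0 = ∣-small⇒0
        (subst (+ p ∣_) (ℤ.+-identityˡ _) (zero-coord h0 i))
        (ℕ.≤-<-trans (∣total∣≤ (isBase i) T) b<p)

  headless⇒balanced : ∀ T → heads (letters T) ≡ 0 → signedHeads T ≡ + 0
  headless⇒balanced T h0 = ℤ.∣i∣≡0⇒i≡0 (ℕ.n≤0⇒n≡0 (subst (∣ signedHeads T ∣ ≤_) h0 (∣total∣≤ isHead T)))

  -- v ≡ ±b modulo both p and 2, hence modulo 2p, and |v ∓ b| < 2p.
  exact : ∀ {v b} t → ∣ v ∣ ≤ b → b < p → + p ∣ v - signed t (+ b) → + 2 ∣ v - + b → ∣ v ∣ ≡ b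
  exact {v} {b} t v≤b b<p p∣ 2∣ = trans (cong ∣_∣ v≡) (signed-abs t b)
    where
    diff = v - signed t (+ b)
    2∣diff : + 2 ∣ diff
    2∣diff = subst (+ 2 ∣_) (eq v (+ b) (signed t (+ b))) (∣m∣n⇒∣m-n 2∣ (2∣signed- t b))
      where
      eq : ∀ v b c → v - b - (c - b) ≡ v - c
      eq = solve-∀
    2p∣diff : + (2 Nat.* p) ∣ diff
    2p∣diff = ∣ᵤ⇒∣ (both (∣⇒∣ᵤ p∣) (∣⇒∣ᵤ 2∣diff))
      where
      both : p ℕ.∣ ∣ diff ∣ → 2 ℕ.∣ ∣ diff ∣ → (2 Nat.* p) ℕ.∣ ∣ diff ∣
      both (ℕ.divides q eq) 2∣d rewrite eq =
        ℕ.*-monoˡ-∣ p (coprime-divisor (Coprime.sym p⊥2) (subst (2 ℕ.∣_) (ℕ.*-comm q p) 2∣d))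
    small : ∣ diff ∣ < 2 Nat.* p
    small = ℕ.≤-<-trans (ℤ.∣i-j∣≤∣i∣+∣j∣ v (signed t (+ b)))
      (subst (∣ v ∣ Nat.+ ∣ signed t (+ b) ∣ <_) (cong (p Nat.+_) (sym (ℕ.+-identityʳ p)))
        (ℕ.+-mono-≤-< (ℕ.≤-trans v≤b (ℕ.<⇒≤ b<p)) (subst (_< p) (sym (signed-abs t b)) b<p)))
    v≡ : v ≡ signed t (+ b)
    v≡ = ℤ.i-j≡0⇒i≡j v _ (∣-small⇒0 2p∣diff small)

  parity-of-1 : ∀ v → ∣ v ∣ ≤ 1 → + 2 ∣ v - + 1 → Σ Bool λ t → v ≡ signed t (+ 1)
  parity-of-1 (+ 0)             _        2∣ with ∣⇒∣ᵤ 2∣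
  ... | 2∣1 = contradiction (ℕ.∣⇒≤ 2∣1) λ { (s≤s ()) }
  parity-of-1 (+ 1)             _        _  = true , refl
  parity-of-1 (+ suc (suc _))   (s≤s ()) _
  parity-of-1 -[1+ 0 ]          _        _  = false , refl
  parity-of-1 -[1+ suc _ ]      (s≤s ()) _

  parity-of-2 : ∀ v → ∣ v ∣ ≤ 2 → + 2 ∣ v - + 2 → v ≡ + 0 ⊎ Σ Bool λ t → v ≡ signed t (+ 2)
  parity-of-2 (+ 0)                 _              _  = inj₁ refl
  parity-of-2 (+ 1)                 _              2∣ with ∣⇒∣ᵤ 2∣
  ... | 2∣1 = contradiction (ℕ.∣⇒≤ 2∣1) λ { (s≤s ()) }
  parity-of-2 (+ 2)                 _              _  = inj₂ (true , refl)
  parity-of-2 (+ suc (suc (suc _))) (s≤s (s≤s ())) _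
  parity-of-2 -[1+ 0 ]              _              2∣ with ∣⇒∣ᵤ 2∣
  ... | ℕ.divides (suc (suc _)) ()
  parity-of-2 -[1+ 1 ]              _              _  = inj₂ (false , refl)
  parity-of-2 -[1+ suc (suc _) ]    (s≤s (s≤s ())) _

  -- Either all copies of h carry the same sign, or there are two with opposite signs; `X` hands on
  -- the datum that comes with the case m = 2.
  extreme-or-0 : ∀ {m v} {X : Set} → m ≡ 1 ⊎ m ≡ 2 × X → ∣ v ∣ ≤ m → + 2 ∣ v - + m →
    (Σ Bool λ t → v ≡ signed t (+ m)) ⊎ v ≡ + 0 × X
  extreme-or-0 (inj₁ refl)       v≤ 2∣ = inj₁ (parity-of-1 _ v≤ 2∣)
  extreme-or-0 (inj₂ (refl , j)) v≤ 2∣ with parity-of-2 _ v≤ 2∣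
  ... | inj₁ v≡0 = inj₂ (v≡0 , j)
  ... | inj₂ ext = inj₁ ext

  -- For m = 2 the odd exponent bⱼ excludes the two new ways of splitting: both copies of h in one
  -- part with opposite signs, or one copy in each part.
  module PowerAtom (m : ℕ) (b : Fin s → ℕ) (sg : Fin s → Bool) (b<p : ∀ i → b i < p)
    (cong-b : ∀ i → + p ∣ + m * x i - signed (sg i) (+ b i))
    (m-cases : m ≡ 1 ⊎ m ≡ 2 × Σ (Fin s) λ j → ¬ (+ 2 ∣ + b j)) where

    powers-zeroSum : ZeroSum (powers m b)
    powers-zeroSum = map (λ k → label k , k) (powers m b) , letters-label label (powers m b) ,
      λ i → subst (+ p ∣_) (sym (coord-label i)) (cong-b i)
      where
      label : Fin (suc s) → Bool
      label zero    = true
      -- The power of h contributes m xᵢ ≡ ±bᵢ to the i-th coordinate; the letters gᵢ cancel it by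
      -- carrying the opposite sign.
      label (suc i) = not (sg i)
      open ≡-Reasoning
      term : ∀ i k → + b k * signed (not (sg k)) (+ 0 * x i + δ i k) ≡ - signed (sg k) (+ b k) * δ k i
      term i k with sg k
      ... | true  = trans (eq (+ b k) (x i) (δ i k)) (mulˡ (- + b k) (δ-comm i k))
        where
        eq : ∀ b x d → b * (- (+ 0 * x + d)) ≡ - b * d
        eq = solve-∀
      ... | false = trans (eq (+ b k) (x i) (δ i k)) (mulˡ (- - + b k) (δ-comm i k))
        where
        eq : ∀ b x d → b * (+ 0 * x + d) ≡ - (- b) * d
        eq = solve-∀
      coord-label : ∀ i → coord i (map (λ k → label k , k) (powers m b)) ≡ + m * x i - signed (sg i) (+ b i)
      coord-label i = begin
        total (λ k → val k i) (map (λ k → label k , k) (powers m b))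
          ≡⟨ total-label (λ k → val k i) label (powers m b) ⟩
        sumᶻ (λ k → signed (label k) (val k i)) (powers m b)
          ≡⟨ sumᶻ-powers (λ k → signed (label k) (val k i)) m b ⟩
        + m * (+ 1 * x i + + 0) + ∑ (λ k → + b k * signed (not (sg k)) (+ 0 * x i + δ i k))
          ≡⟨ cong₂ _+_ (eq (+ m) (x i)) (trans (sum-cong-≗ (term i)) (∑-δ (λ k → - signed (sg k) (+ b k)) i)) ⟩
        + m * x i - signed (sg i) (+ b i) ∎
        where
        eq : ∀ m x → m * (+ 1 * x + + 0) ≡ m * x
        eq = solve-∀

    0<m : 0 < m
    0<m = positive m-cases
      where
      positive : ∀ {m X} → m ≡ 1 ⊎ m ≡ 2 × X → 0 < m
      positive (inj₁ refl)       = s≤s z≤n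
      positive (inj₂ (refl , _)) = s≤s z≤n

    record Splitting (T U : List (Bool × Fin (suc s))) : Set where
      field
        T-zero  : Zero T
        U-zero  : Zero U
        heads≡  : heads (letters T) Nat.+ heads (letters U) ≡ m
        bases≡  : ∀ i → bases i (letters T) Nat.+ bases i (letters U) ≡ b i

      basesT≤ : ∀ i → bases i (letters T) ≤ b i
      basesT≤ i = subst (bases i (letters T) ≤_) (bases≡ i) (ℕ.m≤m+n _ _)

      basesU≤ : ∀ i → bases i (letters U) ≤ b i
      basesU≤ i = subst (bases i (letters U) ≤_) (bases≡ i) (ℕ.m≤n+m _ _)

    open Splitting

    splitting-sym : ∀ {T U} → Splitting T U → Splitting U T
    splitting-sym {T} {U} S = record
      { T-zero = U-zero S ; U-zero = T-zero S
      ; heads≡ = trans (ℕ.+-comm (heads (letters U)) _) (heads≡ S)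
      ; bases≡ = λ i → trans (ℕ.+-comm (bases i (letters U)) _) (bases≡ S i) }

    -- All copies of h lie in `T`, and `U` contains each gᵢ an even number of times. If the copies
    -- have equal signs, the signed number of gᵢ in `T` is ±bᵢ modulo p and has the parity of bᵢ, so
    -- by `exact` all bᵢ letters are in `T`. If they cancel, `T` also contains each gᵢ an even
    -- number of times, against bⱼ being odd.
    headless-part-empty : ∀ {T U} → Splitting T U → heads (letters U) ≡ 0 → letters U ≡ []
    headless-part-empty {T} {U} S hU≡0 = headless-baseless⇒[] (letters U) hU≡0 (basesU≡0 headsT)
      where
      hT≡m : heads (letters T) ≡ m
      hT≡m = trans (trans (sym (ℕ.+-identityʳ _)) (cong (heads (letters T) Nat.+_) (sym hU≡0))) (heads≡ S)
      hT≤m : ∣ signedHeads T ∣ ≤ m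
      hT≤m = subst (∣ signedHeads T ∣ ≤_) hT≡m (∣total∣≤ isHead T)
      hT-parity : + 2 ∣ signedHeads T - + m
      hT-parity = subst (λ n → + 2 ∣ signedHeads T - + n) hT≡m (total-parity isHead T)
      U-even : ∀ i → + 2 ∣ + bases i (letters U)
      U-even i = balanced-even {U} (U-zero S) (headless⇒balanced U hU≡0) (ℕ.≤-<-trans (basesU≤ S i) (b<p i))
      headsT : Σ Bool λ t → signedHeads T ≡ signed t (+ m)
      headsT with extreme-or-0 m-cases hT≤m hT-parity
      ... | inj₁ t                  = t
      ... | inj₂ (hT≡0 , j , b-odd) = contradiction
        (subst (λ n → + 2 ∣ + n) (bases≡ S j)
          (∣m∣n⇒∣m+n (balanced-even {T} (T-zero S) hT≡0 (ℕ.≤-<-trans (basesT≤ S j) (b<p j))) (U-even j))) b-odd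
      basesU≡0 : (Σ Bool λ t → signedHeads T ≡ signed t (+ m)) → ∀ i → bases i (letters U) ≡ 0
      basesU≡0 (t , hT≡) i = ℕ.+-cancelˡ-≡ (b i) _ _ (ℕ.≤-antisym
        (ℕ.≤-trans (ℕ.+-monoˡ-≤ (bases i (letters U)) b≤) (ℕ.≤-reflexive (trans (bases≡ S i) (sym (ℕ.+-identityʳ _)))))
        (ℕ.+-monoʳ-≤ (b i) z≤n))
        where
        v = signedBases i T
        p∣ : ∀ t u → signedHeads T ≡ signed t (+ m) → + p ∣ + m * x i - signed u (+ b i) →
          Σ Bool λ w → + p ∣ v - signed w (+ b i)
        p∣ true  true  h c = false , subst (+ p ∣_) (eq (+ m) (x i) v (+ b i)) (∣m∣n⇒∣m-n (zero-coord {T} (T-zero S) h i) c)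
          where
          eq : ∀ m x v b → m * x + v - (m * x - b) ≡ v - - b
          eq = solve-∀
        p∣ true  false h c = true , subst (+ p ∣_) (eq (+ m) (x i) v (+ b i)) (∣m∣n⇒∣m-n (zero-coord {T} (T-zero S) h i) c)
          where
          eq : ∀ m x v b → m * x + v - (m * x - - b) ≡ v - b
          eq = solve-∀
        p∣ false true  h c = true , subst (+ p ∣_) (eq (+ m) (x i) v (+ b i)) (∣m∣n⇒∣m+n (zero-coord {T} (T-zero S) h i) c)
          where
          eq : ∀ m x v b → - m * x + v + (m * x - b) ≡ v - b
          eq = solve-∀
        p∣ false false h c = false , subst (+ p ∣_) (eq (+ m) (x i) v (+ b i)) (∣m∣n⇒∣m+n (zero-coord {T} (T-zero S) h i) c)
          where
          eq : ∀ m x v b → - m * x + v + (m * x - - b) ≡ v - - b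
          eq = solve-∀
        v≡±b = p∣ t (sg i) hT≡ (cong-b i)
        2∣ : + 2 ∣ v - + b i
        2∣ = subst (+ 2 ∣_) (trans (eq v (+ bases i (letters T)) (+ bases i (letters U))) (cong (λ n → v - + n) (bases≡ S i)))
          (∣m∣n⇒∣m-n (total-parity (isBase i) T) (U-even i))
          where
          eq : ∀ v a c → v - a - c ≡ v - (a + c)
          eq = solve-∀
        b≤ : b i ≤ bases i (letters T)
        b≤ = subst (_≤ bases i (letters T))
          (exact {v} (proj₁ v≡±b) (ℕ.≤-trans (∣total∣≤ (isBase i) T) (basesT≤ S i)) (b<p i) (proj₂ v≡±b) 2∣)
          (∣total∣≤ (isBase i) T)

    -- With one h in each part, the signed numbers v and w of letters gⱼ are both ≡ ±xⱼ, so v ≡ ±w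
    -- modulo p. Since |v| + |w| ≤ bⱼ < p this is an equality; then v + w is even, and it has the
    -- parity of bⱼ.
    heads-not-split : ∀ {T U} → Splitting T U → heads (letters T) ≡ 1 → heads (letters U) ≡ 1 → ⊥
    heads-not-split {T} {U} S hT≡1 hU≡1 = not-two m-cases
      where
      unit : ∀ V → heads (letters V) ≡ 1 → Σ Bool λ t → signedHeads V ≡ signed t (+ 1)
      unit V h≡1 = parity-of-1 _ (subst (∣ signedHeads V ∣ ≤_) h≡1 (∣total∣≤ isHead V))
                                 (subst (λ n → + 2 ∣ signedHeads V - + n) h≡1 (total-parity isHead V))
      module OddBase (j : Fin s) where
        v = signedBases j T
        w = signedBases j U
        coord-T : ∀ {z} → signedHeads T ≡ z → + p ∣ z * x j + v
        coord-T h = zero-coord {T} (T-zero S) h j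
        coord-U : ∀ {z} → signedHeads U ≡ z → + p ∣ z * x j + w
        coord-U h = zero-coord {U} (U-zero S) h j
        ∣v∣+∣w∣<p : ∣ v ∣ Nat.+ ∣ w ∣ < p
        ∣v∣+∣w∣<p = ℕ.≤-<-trans (ℕ.≤-trans (ℕ.+-mono-≤ (∣total∣≤ (isBase j) T) (∣total∣≤ (isBase j) U))
                                            (ℕ.≤-reflexive (bases≡ S j))) (b<p j)
        v+w-parity : + 2 ∣ + b j - (v + w)
        v+w-parity = subst (+ 2 ∣_) (trans (eq v w (+ bases j (letters T)) (+ bases j (letters U)))
                                           (cong (λ n → + n - (v + w)) (bases≡ S j)))
          (∣m⇒∣-m (∣m∣n⇒∣m+n (total-parity (isBase j) T) (total-parity (isBase j) U)))
          where
          eq : ∀ v w a c → - (v - a + (w - c)) ≡ a + c - (v + w)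
          eq = solve-∀
        v+w≡0 : + p ∣ v + w → + 2 ∣ + b j
        v+w≡0 p∣ = ∣-resp-- v+w-parity (subst (+ 2 ∣_)
          (sym (∣-small⇒0 p∣ (ℕ.≤-<-trans (ℤ.∣i+j∣≤∣i∣+∣j∣ v w) ∣v∣+∣w∣<p))) (divides (+ 0) refl))
        v-w≡0 : + p ∣ v - w → + 2 ∣ + b j
        v-w≡0 p∣ = ∣-resp-- v+w-parity (subst (+ 2 ∣_) (cong (λ z → v + z) (ℤ.i-j≡0⇒i≡j v w
          (∣-small⇒0 p∣ (ℕ.≤-<-trans (ℤ.∣i-j∣≤∣i∣+∣j∣ v w) ∣v∣+∣w∣<p)))) (divides v (eq v)))
          where
          eq : ∀ v → v + v ≡ v * + 2
          eq = solve-∀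
        even : (Σ Bool λ t → signedHeads T ≡ signed t (+ 1)) → (Σ Bool λ t → signedHeads U ≡ signed t (+ 1)) →
          + 2 ∣ + b j
        even (true  , hT) (true  , hU) = v-w≡0 (subst (+ p ∣_) (eq (x j) v w) (∣m∣n⇒∣m-n (coord-T hT) (coord-U hU)))
          where
          eq : ∀ x v w → + 1 * x + v - (+ 1 * x + w) ≡ v - w
          eq = solve-∀
        even (true  , hT) (false , hU) = v+w≡0 (subst (+ p ∣_) (eq (x j) v w) (∣m∣n⇒∣m+n (coord-T hT) (coord-U hU)))
          where
          eq : ∀ x v w → + 1 * x + v + (- + 1 * x + w) ≡ v + w
          eq = solve-∀
        even (false , hT) (true  , hU) = v+w≡0 (subst (+ p ∣_) (eq (x j) v w) (∣m∣n⇒∣m+n (coord-T hT) (coord-U hU)))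
          where
          eq : ∀ x v w → - + 1 * x + v + (+ 1 * x + w) ≡ v + w
          eq = solve-∀
        even (false , hT) (false , hU) = v-w≡0 (subst (+ p ∣_) (eq (x j) v w) (∣m∣n⇒∣m-n (coord-T hT) (coord-U hU)))
          where
          eq : ∀ x v w → - + 1 * x + v - (- + 1 * x + w) ≡ v - w
          eq = solve-∀
      not-two : m ≡ 1 ⊎ m ≡ 2 × (Σ (Fin s) λ j → ¬ (+ 2 ∣ + b j)) → ⊥
      not-two (inj₁ m≡1) = contradiction (trans (sym (cong₂ Nat._+_ hT≡1 hU≡1)) (trans (heads≡ S) m≡1)) λ ()
      not-two (inj₂ (_ , j , b-odd)) = b-odd (OddBase.even j (unit T hT≡1) (unit U hU≡1))

    splitting-trivial : ∀ {T U} → Splitting T U → letters T ≡ [] ⊎ letters U ≡ []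
    splitting-trivial {T} {U} S with heads (letters T) in hT | heads (letters U) in hU
    ... | zero  | _     = inj₁ (headless-part-empty (splitting-sym S) hT)
    ... | suc _ | zero  = inj₂ (headless-part-empty S hU)
    ... | suc (suc a) | suc c = contradiction (trans (sym (cong₂ Nat._+_ hT hU)) (heads≡ S)) (too-many m-cases)
      where
      too-many : ∀ {m X} → m ≡ 1 ⊎ m ≡ 2 × X → suc (suc a) Nat.+ suc c ≢ m
      too-many (inj₁ refl) ()
      too-many (inj₂ (refl , _)) eq rewrite ℕ.+-suc a c = contradiction eq λ ()
    ... | suc zero | suc (suc c) = contradiction (trans (sym (cong₂ Nat._+_ hT hU)) (heads≡ S)) (too-many m-cases)
      where
      too-many : ∀ {m X} → m ≡ 1 ⊎ m ≡ 2 × X → 3 Nat.+ c ≢ m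
      too-many (inj₁ refl) ()
      too-many (inj₂ (refl , _)) ()
    ... | suc zero | suc zero = ⊥-elim (heads-not-split S hT hU)

    powers-atom : Atom B (powers m b)
    powers-atom = powers-zeroSum , (λ eq → ℕ.<⇒≢ 0<m (trans (sym (cong heads eq)) (heads-powers m b))) , ¬split
      where
      split-sum : ∀ f {S T U} → S ↭ T ++ U → sum (map f T) Nat.+ sum (map f U) ≡ sum (map f S)
      split-sum f {S} {T} {U} σ = trans (sym (sum-++ (map f T) (map f U)))
        (trans (cong sum (sym (map-++ f T U))) (sum-↭ (map⁺ f (↭-sym σ))))
      ¬split : ¬ (Σ (List (Fin (suc s))) λ c → Σ (List (Fin (suc s))) λ d →
                  B c × B d × c ≢ [] × d ≢ [] × powers m b ↭ (c ++ d))
      ¬split (_ , _ , (T , refl , T-zero) , (U , refl , U-zero) , T≢[] , U≢[] , σ)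
        with splitting-trivial {T} {U} (record
          { T-zero = T-zero ; U-zero = U-zero
          ; heads≡ = trans (split-sum isHead {T = letters T} {letters U} σ) (heads-powers m b)
          ; bases≡ = λ i → trans (split-sum (isBase i) {T = letters T} {letters U} σ) (bases-powers i m b) })
      ... | inj₁ T≡[] = T≢[] T≡[]
      ... | inj₂ U≡[] = U≢[] U≡[]

-- Divisibilities forced by power atoms

module OddPrime (p : ℕ) (p-prime : Prime p) (p≢2 : p ≢ 2) where
  open Int using (_+_; _*_; -_; _-_)

  2≤p : 2 ≤ p
  2≤p = ℕ.nonTrivial⇒n>1 p {{prime⇒nonTrivial p-prime}}

  2<p : 2 < p
  2<p = ℕ.≤∧≢⇒< 2≤p (p≢2 ∘ sym)

  p⊥2 : Coprime p 2
  p⊥2 (i∣p , i∣2) with prime⇒irreducible p-prime i∣p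
  ... | inj₁ i≡1  = i≡1
  ... | inj₂ refl = contradiction (ℕ.∣⇒≤ i∣2) (ℕ.<⇒≱ 2<p)

  2∤p : ¬ 2 ℕ.∣ p
  2∤p 2∣p = contradiction (p⊥2 (2∣p , ℕ.∣-refl)) λ ()

  p-2+2≡p : p Nat.∸ 2 Nat.+ 2 ≡ p
  p-2+2≡p = ℕ.m∸n+n≡m 2≤p

  ∣p-2⇒⊥2 : ∀ {D} → D ℕ.∣ p Nat.∸ 2 → Coprime D 2
  ∣p-2⇒⊥2 D∣ (i∣D , i∣2) =
    p⊥2 (subst (_ ℕ.∣_) p-2+2≡p (ℕ.∣m∣n⇒∣m+n (ℕ.∣-trans i∣D D∣) i∣2) , i∣2)

  ∣p-2⇒>0 : ∀ {D} → D ℕ.∣ p Nat.∸ 2 → 0 < D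
  ∣p-2⇒>0 D∣ = ℕ.n≢0⇒n>0 λ D≡0 →
    ℕ.<⇒≢ (ℕ.m<n⇒0<n∸m 2<p) (sym (ℕ.0∣⇒≡0 (subst (ℕ._∣ p Nat.∸ 2) D≡0 D∣)))

  euclid : ∀ x y → + p ∣ x * y → (+ p ∣ x) ⊎ (+ p ∣ y)
  euclid x y p∣ with euclidsLemma ∣ x ∣ ∣ y ∣ p-prime (subst (p ℕ.∣_) (ℤ.abs-* x y) (∣⇒∣ᵤ p∣))
  ... | inj₁ p∣x = inj₁ (∣ᵤ⇒∣ p∣x)
  ... | inj₂ p∣y = inj₂ (∣ᵤ⇒∣ p∣y)

  +∸ : ∀ {m n} → n ≤ m → + (m Nat.∸ n) ≡ + m - + n
  +∸ {m} {n} n≤m = sym (trans (ℤ.m-n≡m⊖n m n) (ℤ.⊖-≥ n≤m))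

  -- Realizes the abstract letters of `PowerSequences` inside `G`, so that each atom found there
  -- yields a divisibility by `D`.
  module Span {G : Set} {r : ℕ} (val : G → Fin r → ℤ) {s : ℕ} (g : Fin s → G)
    (indep : Independent p (λ i → val (g i))) (h : G) (x : Fin s → ℤ)
    (h≡ : ∀ j → + p ∣ val h j - ∑ (λ i → x i * val (g i) j))
    {Q : G → Set} (g∈Q : ∀ i → Q (g i)) (h∈Q : Q h) {D : ℕ}
    (congr : Arithmetic.AtomsCongruent (ZeroSums.zeroSums p val) Q D) where

    module P = PowerSequences p p⊥2 x

    γ : Fin (suc s) → G
    γ zero    = h
    γ (suc i) = g i

    γ∈Q : ∀ k → Q (γ k)
    γ∈Q zero    = h∈Q
    γ∈Q (suc i) = g∈Q i

    γ-val : ∀ k j → + p ∣ val (γ k) j - ∑ (λ i → P.val k i * val (g i) j)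
    γ-val zero    j = subst (λ y → + p ∣ val h j - y) (sum-cong-≗ λ i → eq (x i) (val (g i) j)) (h≡ j)
      where
      eq : ∀ x v → x * v ≡ (+ 1 * x + + 0) * v
      eq = solve-∀
    γ-val (suc k) j = subst (+ p ∣_) (sym (trans (cong (λ y → val (g k) j - y) sum≡) (ℤ.+-inverseʳ (val (g k) j))))
                            (divides (+ 0) refl)
      where
      eq : ∀ x d v → (+ 0 * x + d) * v ≡ v * d
      eq = solve-∀
      sum≡ : ∑ (λ i → (+ 0 * x i + δ i k) * val (g i) j) ≡ val (g k) j
      sum≡ = trans (sum-cong-≗ λ i → eq (x i) (δ i k) (val (g i) j)) (∑-δ (λ i → val (g i) j) k)

    open Coordinates p P.val val γ (λ i → val (g i)) indep γ-val

    -- A positive exponent gives the atom length at least 2; its weight is then its length, and the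
    -- subtraction of 2 is not truncated.
    power-congruent : ∀ m (b : Fin s → ℕ) (sg : Fin s → Bool) → (∀ i → b i < p) →
      (∀ i → + p ∣ + m * x i - signed (sg i) (+ b i)) →
      m ≡ 1 ⊎ m ≡ 2 × (Σ (Fin s) λ j → ¬ (+ 2 ∣ + b j)) → (Σ (Fin s) λ i → 0 < b i) →
      + D ∣ + m + ∑ (+_ ∘ b) - + 2
    power-congruent m b sg b<p cong-b m-cases (i , 0<bi) =
      subst (+ D ∣_) (trans (+∸ 2≤len) (cong (_- + 2) (P.length-powers m b)))
        (∣ᵤ⇒∣ (subst (λ w → D ℕ.∣ w Nat.∸ 2) (K.long-atom-weight powers-atom 2≤len)
          (congruent-pullback {Q′ = λ _ → ⊤} (λ {k} _ → γ∈Q k) congr powers-atom (All.universal (λ _ → tt) _))))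
      where
      open P.PowerAtom m b sg b<p cong-b m-cases
      2≤len : 2 ≤ length (P.powers m b)
      2≤len = ℕ.≤-trans (ℕ.+-mono-≤ 0<m 0<bi)
        (subst₂ (λ x y → x Nat.+ y ≤ length (P.powers m b)) (P.heads-powers m b) (P.bases-powers i m b)
                (P.heads+bases≤length i (P.powers m b)))

    pick : Bool → ℕ → ℕ
    pick true  y = y
    pick false y = p Nat.∸ y

    -- Comparing the two atoms that differ only in replacing the exponent yᵢ of gᵢ by p − yᵢ.
    flip-congruent : ∀ m (y : Fin s → ℕ) → (∀ i → y i < p) → (∀ i → + p ∣ + m * x i - + y i) →
      ∀ i → 0 < y i → (choice : Fin s → Bool) → (∀ k → choice k ≡ false → 0 < y k) → choice i ≡ true →
      m ≡ 1 ⊎ m ≡ 2 × (Σ (Fin s) λ j → i ≢ j × ¬ (+ 2 ∣ + pick (choice j) (y j))) →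
      + D ∣ + 2 * + y i - + p
    flip-congruent m y y<p cong-y i 0<yi choice valid choice-i m-cases =
      subst (+ D ∣_) difference (∣m∣n⇒∣m-n (apply choice valid (odd m-cases)) (apply choice′ valid′ (odd′ m-cases)))
      where
      b : (Fin s → Bool) → Fin s → ℕ
      b c k = pick (c k) (y k)
      choice′ : Fin s → Bool
      choice′ k with k Fin.≟ i
      ... | yes _ = false
      ... | no  _ = choice k
      choice′-≢ : ∀ {k} → k ≢ i → choice′ k ≡ choice k
      choice′-≢ {k} k≢i with k Fin.≟ i
      ... | yes k≡i = contradiction k≡i k≢i
      ... | no  _   = refl
      valid′ : ∀ k → choice′ k ≡ false → 0 < y k
      valid′ k eq with k Fin.≟ i
      ... | yes refl = 0<yi
      ... | no  _    = valid k eq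
      pick<p : ∀ t {n} → n < p → (t ≡ false → 0 < n) → pick t n < p
      pick<p true  n<p _   = n<p
      pick<p false {n} n<p 0<n = ℕ.∸-monoʳ-< (0<n refl) (ℕ.<⇒≤ n<p)
      0<pick : ∀ t {n} → n < p → 0 < n → 0 < pick t n
      0<pick true  n<p 0<n = 0<n
      0<pick false n<p 0<n = ℕ.m<n⇒0<n∸m n<p
      pick-cong : ∀ t {n z} → n < p → + p ∣ z - + n → + p ∣ z - signed t (+ pick t n)
      pick-cong true  _   p∣ = p∣
      pick-cong false {n} {z} n<p p∣ = subst (+ p ∣_)
        (trans (eq z (+ n) (+ p)) (cong (λ w → z - - w) (sym (+∸ (ℕ.<⇒≤ n<p)))))
        (∣m∣n⇒∣m+n p∣ (divides (+ 1) (sym (ℤ.*-identityˡ (+ p)))))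
        where
        eq : ∀ z n p → z - n + p ≡ z - - (p - n)
        eq = solve-∀
      apply : (c : Fin s → Bool) → (∀ k → c k ≡ false → 0 < y k) →
        m ≡ 1 ⊎ m ≡ 2 × (Σ (Fin s) λ j → ¬ (+ 2 ∣ + b c j)) → + D ∣ + m + ∑ (+_ ∘ b c) - + 2
      apply c c-valid cases = power-congruent m (b c) c (λ k → pick<p (c k) (y<p k) (c-valid k))
        (λ k → pick-cong (c k) {z = + m * x k} (y<p k) (cong-y k)) cases (i , 0<pick (c i) (y<p i) 0<yi)
      odd : m ≡ 1 ⊎ m ≡ 2 × (Σ (Fin s) λ j → i ≢ j × ¬ (+ 2 ∣ + b choice j)) →
        m ≡ 1 ⊎ m ≡ 2 × (Σ (Fin s) λ j → ¬ (+ 2 ∣ + b choice j))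
      odd (inj₁ m≡1)                 = inj₁ m≡1
      odd (inj₂ (m≡2 , j , _ , odd)) = inj₂ (m≡2 , j , odd)
      -- The exchange at i leaves the odd exponent at j ≠ i in place, so the second sequence is an
      -- atom as well.
      odd′ : m ≡ 1 ⊎ m ≡ 2 × (Σ (Fin s) λ j → i ≢ j × ¬ (+ 2 ∣ + b choice j)) →
        m ≡ 1 ⊎ m ≡ 2 × (Σ (Fin s) λ j → ¬ (+ 2 ∣ + b choice′ j))
      odd′ (inj₁ m≡1)                   = inj₁ m≡1
      odd′ (inj₂ (m≡2 , j , i≢j , odd)) =
        inj₂ (m≡2 , j , subst (λ t → ¬ (+ 2 ∣ + pick t (y j))) (sym (choice′-≢ (i≢j ∘ sym))) odd)
      -- The exchange changes the length by yᵢ - (p - yᵢ).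
      e = + 2 * + y i - + p
      pointwise : ∀ k → + b choice k ≡ + b choice′ k + e * δ k i
      pointwise k with k Fin.≟ i
      ... | yes refl rewrite choice-i | δℕ-refl k = trans (eq (+ y k) (+ p)) (cong (_+ (+ 2 * + y k - + p) * + 1) (sym (+∸ (ℕ.<⇒≤ (y<p k)))))
        where
        eq : ∀ y p → y ≡ p - y + (+ 2 * y - p) * + 1
        eq = solve-∀
      ... | no  k≢i rewrite δℕ-≢ k≢i = sym (trans (addˡ (+ b choice k) (ℤ.*-zeroʳ e)) (ℤ.+-identityʳ _))
      difference : + m + ∑ (+_ ∘ b choice) - + 2 - (+ m + ∑ (+_ ∘ b choice′) - + 2) ≡ e
      difference = trans (cong (λ w → + m + w - + 2 - (+ m + ∑ (+_ ∘ b choice′) - + 2)) (begin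
        ∑ (+_ ∘ b choice)                             ≡⟨ sum-cong-≗ pointwise ⟩
        ∑ (λ k → + b choice′ k + e * δ k i)           ≡⟨ ∑-distrib-+ (+_ ∘ b choice′) (λ k → e * δ k i) ⟩
        ∑ (+_ ∘ b choice′) + ∑ (λ k → e * δ k i)      ≡⟨ addˡ (∑ (+_ ∘ b choice′)) (∑-δ (λ _ → e) i) ⟩
        ∑ (+_ ∘ b choice′) + e                        ∎)) (eq (+ m) (∑ (+_ ∘ b choice′)) e)
        where
        open ≡-Reasoning
        eq : ∀ m z e → m + (z + e) - + 2 - (m + z - + 2) ≡ e
        eq = solve-∀

  module _ {G : Set} {r : ℕ} (val : G → Fin r → ℤ) where
    open Arithmetic (ZeroSums.zeroSums p val)

    single-independent : ∀ {g} → NonzeroLetter g → Independent p {1} (λ _ → val g)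
    single-independent {g} g≢0 c p∣ zero with Fin.¬∀⟶∃¬ r _ (λ j → + p ∣? val g j) (g≢0 ∘ ZeroSums.zero-letter⁺ p val)
    ... | j , p∤ with euclid (c zero) (val g j) (subst (+ p ∣_) (ℤ.+-identityʳ _) (p∣ j))
    ...   | inj₁ p∣c = p∣c
    ...   | inj₂ p∣v = contradiction p∣v p∤

    -- The atom h g^b, where h = b g, has length b + 1.
    multiple-congruent : ∀ {Q D g h} (b : ℕ) → AtomsCongruent Q D → NonzeroLetter g → Q g → Q h →
      (∀ j → + p ∣ val h j - + b * val g j) → 0 < b → b < p → D ℕ.∣ b Nat.∸ 1
    multiple-congruent {D = D} {g} {h} b congr g≢0 g∈Q h∈Q h≡ 0<b b<p =
      ∣⇒∣ᵤ (subst (+ D ∣_) (trans (eq (+ b)) (sym (+∸ 0<b)))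
        (power-congruent 1 (λ _ → b) (λ _ → true) (λ _ → b<p)
          (λ _ → divides (+ 0) (eq₀ (+ b))) (inj₁ refl) (zero , 0<b)))
      where
      open Span val {1} (λ _ → g) (single-independent g≢0) h (λ _ → + b)
        (λ j → subst (λ w → + p ∣ val h j - w) (sym (ℤ.+-identityʳ _)) (h≡ j)) (λ _ → g∈Q) h∈Q congr
      eq : ∀ b → + 1 + (b + + 0) - + 2 ≡ b - + 1
      eq = solve-∀
      eq₀ : ∀ b → + 1 * b - b ≡ + 0 * + p
      eq₀ = λ b → trans (cong (_- b) (ℤ.*-identityˡ b)) (ℤ.+-inverseʳ b)

    -- The atom g^p is read as h g^(p - 1) with h = g and x = 1; as p - 1 ≡ -x, the sign is `false`.
    congruent⇒∣p-2 : ∀ {Q D g} → AtomsCongruent Q D → NonzeroLetter g → Q g → D ℕ.∣ p Nat.∸ 2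
    congruent⇒∣p-2 {D = D} {g} congr g≢0 g∈Q = ∣⇒∣ᵤ (subst (+ D ∣_)
      (trans (cong (λ w → + 1 + (w + + 0) - + 2) (+∸ 1≤p)) (trans (eq (+ p)) (sym (+∸ 2≤p))))
      (power-congruent 1 (λ _ → p Nat.∸ 1) (λ _ → false) (λ _ → ℕ.∸-monoʳ-< (s≤s z≤n) 1≤p)
        (λ _ → divides (+ 1) (trans (cong (λ w → + 1 * + 1 - - w) (+∸ 1≤p)) (eq₁ (+ p)))) (inj₁ refl)
        (zero , ℕ.m<n⇒0<n∸m 2≤p)))
      where
      1≤p : 1 ≤ p
      1≤p = ℕ.<⇒≤ 2≤p
      eq₀ : ∀ v → v - (+ 1 * v + + 0) ≡ + 0
      eq₀ = solve-∀
      open Span val {1} (λ _ → g) (single-independent g≢0) g (λ _ → + 1)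
        (λ j → divides (+ 0) (trans (eq₀ (val g j)) refl)) (λ _ → g∈Q) g∈Q congr
      eq : ∀ p → + 1 + (p - + 1 + + 0) - + 2 ≡ p - + 2
      eq = solve-∀
      eq₁ : ∀ p → + 1 * + 1 - - (p - + 1) ≡ + 1 * p
      eq₁ = solve-∀

    -- Coordinate i is the one exchanged, once with h and once with h²; coordinate j provides the
    -- odd exponent that makes the sequences with h² atoms.
    two-coordinates⇒1 : ∀ {Q D s} (g : Fin s → G) → Independent p (λ i → val (g i)) → (∀ i → Q (g i)) →
      ∀ {h} → Q h → (x : Fin s → Fin p) → (∀ j → + p ∣ val h j - ∑ (λ i → + toℕ (x i) * val (g i) j)) →
      ∀ {i j} → i ≢ j → toℕ (x i) ≢ 0 → toℕ (x j) ≢ 0 →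
      AtomsCongruent Q D → D ℕ.∣ p Nat.∸ 2 → D ≡ 1
    two-coordinates⇒1 {D = D} {s} g indep g∈Q h∈Q x h≡ {i} {j} i≢j xi≢0 xj≢0 congr D∣p-2 =
      ∣p-2⇒⊥2 D∣p-2 (ℕ.∣-refl , ∣⇒∣ᵤ D∣2)
      where
      open Span val g indep _ (λ i → + toℕ (x i)) h≡ g∈Q h∈Q congr
      instance
        p≢0 : NonZero p
        p≢0 = prime⇒nonZero p-prime
      D∣p-2ᶻ : + D ∣ + p - + 2
      D∣p-2ᶻ = subst (+ D ∣_) (+∸ 2≤p) (∣ᵤ⇒∣ D∣p-2)
      y : Fin s → ℕ
      y k = (2 Nat.* toℕ (x k)) ℕ.% p
      q : Fin s → ℕ
      q k = (2 Nat.* toℕ (x k)) ℕ./ p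
      y+qp : ∀ k → + 2 * + toℕ (x k) ≡ + y k + + q k * + p
      y+qp k = trans (sym (ℤ.pos-* 2 (toℕ (x k)))) (trans (cong +_ (ℕ.m≡m%n+[m/n]*n (2 Nat.* toℕ (x k)) p))
        (addˡ (+ y k) (ℤ.pos-* (q k) p)))
      0<y : ∀ {k} → toℕ (x k) ≢ 0 → 0 < y k
      0<y {k} xk≢0 = ℕ.n≢0⇒n>0 λ y≡0 → p∤2x (ℕ.m%n≡0⇒n∣m _ p y≡0)
        where
        p∤2x : ¬ p ℕ.∣ 2 Nat.* toℕ (x k)
        p∤2x p∣ = contradiction (ℕ.∣⇒≤ {{ℕ.≢-nonZero xk≢0}} (coprime-divisor p⊥2 p∣)) (ℕ.<⇒≱ (Fin.toℕ<n (x k)))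
      -- As p is odd, exactly one of yⱼ and p - yⱼ is odd. The latter is an admissible exponent
      -- below p because xⱼ ≠ 0 gives yⱼ > 0.
      oddPick : Bool
      oddPick with 2 ℕ.∣? y j
      ... | yes _ = false
      ... | no  _ = true
      oddPick-odd : ¬ (+ 2 ∣ + pick oddPick (y j))
      oddPick-odd with 2 ℕ.∣? y j
      ... | no  2∤y = 2∤y ∘ ∣⇒∣ᵤ
      ... | yes 2∣y = λ 2∣p-y → 2∤p (subst (2 ℕ.∣_) (ℕ.m∸n+n≡m (ℕ.<⇒≤ (ℕ.m%n<n _ p)))
                                       (ℕ.∣m∣n⇒∣m+n (∣⇒∣ᵤ 2∣p-y) 2∣y))
      choice : Fin s → Bool
      choice k with k Fin.≟ j
      ... | yes _ = oddPick
      ... | no  _ = true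
      choice-j : choice j ≡ oddPick
      choice-j with j Fin.≟ j
      ... | yes _   = refl
      ... | no  j≢j = contradiction refl j≢j
      choice-i : choice i ≡ true
      choice-i with i Fin.≟ j
      ... | yes i≡j = contradiction i≡j i≢j
      ... | no  _   = refl
      valid : ∀ k → choice k ≡ false → 0 < y k
      valid k eq with k Fin.≟ j
      ... | yes refl = 0<y xj≢0
      valid k () | no _
      X = + toℕ (x i)
      Y = + y i
      R = + q i
      D∣2X-p : + D ∣ + 2 * X - + p
      D∣2X-p = flip-congruent 1 (toℕ ∘ x) (Fin.toℕ<n ∘ x) (λ k → divides (+ 0) (eq (+ toℕ (x k))))
        i (ℕ.n≢0⇒n>0 xi≢0) (λ _ → true) (λ _ ()) refl (inj₁ refl)
        where
        eq : ∀ b → + 1 * b - b ≡ + 0 * + p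
        eq b = trans (cong (_- b) (ℤ.*-identityˡ b)) (ℤ.+-inverseʳ b)
      D∣2Y-p : + D ∣ + 2 * Y - + p
      D∣2Y-p = flip-congruent 2 y (λ k → ℕ.m%n<n _ p)
        (λ k → divides (+ q k) (trans (cong (_- + y k) (y+qp k)) (eq (+ y k) (+ q k * + p))))
        i (0<y xi≢0) choice valid choice-i
        (inj₂ (refl , j , i≢j , subst (λ t → ¬ (+ 2 ∣ + pick t (y j))) (sym choice-j) oddPick-odd))
        where
        eq : ∀ y z → y + z - y ≡ z
        eq = solve-∀
      -- 2Y ≡ p and 2X ≡ p ≡ 2 give 2 ≡ 4 − 4q modulo D, and q is 0 or 1.
      D∣4q-2 : + D ∣ + 2 - + 4 * R
      D∣4q-2 = subst (+ D ∣_) (eq Y R (+ p)) (∣m∣n⇒∣m-n (∣n⇒∣m*n (+ 2 * R - + 1) D∣p-2ᶻ)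
        (∣m∣n⇒∣m-n (∣n⇒∣m*n (+ 2) (subst (λ w → + D ∣ w - + p) (y+qp i) D∣2X-p)) D∣2Y-p))
        where
        eq : ∀ Y R p → (+ 2 * R - + 1) * (p - + 2) - (+ 2 * (Y + R * p - p) - (+ 2 * Y - p)) ≡ + 2 - + 4 * R
        eq = solve-∀
      D∣2 : + D ∣ + 2
      D∣2 = cases (q i) refl (ℕ.m<n*o⇒m/o<n {2 Nat.* toℕ (x i)} {2} {p} (ℕ.*-monoʳ-< 2 (Fin.toℕ<n (x i))))
        where
        cases : ∀ n → q i ≡ n → n < 2 → + D ∣ + 2
        cases 0 eq _ = subst (λ n → + D ∣ + 2 - + 4 * + n) eq D∣4q-2
        cases 1 eq _ = ∣m⇒∣-m (subst (λ n → + D ∣ + 2 - + 4 * + n) eq D∣4q-2)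
        cases (suc (suc _)) _ (s≤s (s≤s ()))

-- Deciding whether a sequence is an atom

module _ {G : Set} where

  take-+ : ∀ i k (xs : List G) → take (i Nat.+ k) xs ≡ take i xs ++ take k (drop i xs)
  take-+ zero    k xs       = refl
  take-+ (suc i) zero    [] = refl
  take-+ (suc i) (suc k) [] = refl
  take-+ (suc i) k (x ∷ xs) = cong (x ∷_) (take-+ i k xs)

  nonempty? : ∀ (xs : List G) → Dec (xs ≢ [])
  nonempty? []      = no λ []≢[] → []≢[] refl
  nonempty? (_ ∷ _) = yes λ ()

  labelling? : ∀ {P : List (Bool × G) → Set} → Decidable P → ∀ S → Dec (Σ (List (Bool × G)) λ T → letters T ≡ S × P T)
  labelling? P? [] with P? []
  ... | yes p = yes ([] , refl , p)
  ... | no ¬p = no λ { ([] , refl , p) → ¬p p }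
  labelling? P? (g ∷ S) with labelling? (λ T → P? ((true , g) ∷ T)) S | labelling? (λ T → P? ((false , g) ∷ T)) S
  ... | yes (T , refl , p) | _                  = yes ((true , g) ∷ T , refl , p)
  ... | no _               | yes (T , refl , p) = yes ((false , g) ∷ T , refl , p)
  ... | no ¬t              | no ¬f              = no λ
    { ((true  , _) ∷ T , refl , p) → ¬t (T , refl , p)
    ; ((false , _) ∷ T , refl , p) → ¬f (T , refl , p) }

  -- The labels now record to which of two factors a letter belongs, so the exhaustive search that
  -- finds signs finds splittings as well.
  select : Bool → List (Bool × G) → List G
  select t T = letters (filter (λ x → proj₁ x Bool.≟ t) T)

  select-split : ∀ T → letters T ↭ select true T ++ select false T
  select-split []                = ↭-refl
  select-split ((true  , g) ∷ T) = prep g (select-split T)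
  select-split ((false , g) ∷ T) = ↭-trans (prep g (select-split T)) (↭-sym (shift g (select true T) (select false T)))

  select-labelled : ∀ b c → let T = map (true ,_) b ++ map (false ,_) c in select true T ≡ b × select false T ≡ c
  select-labelled []      []      = refl , refl
  select-labelled []      (x ∷ c) = proj₁ (select-labelled [] c) , cong (x ∷_) (proj₂ (select-labelled [] c))
  select-labelled (x ∷ b) c       = cong (x ∷_) (proj₁ (select-labelled b c)) , proj₂ (select-labelled b c)

  letters-labelled : ∀ (b c : List G) → letters (map (true ,_) b ++ map (false ,_) c) ≡ b ++ c
  letters-labelled []      []      = refl
  letters-labelled []      (x ∷ c) = cong (x ∷_) (letters-labelled [] c)
  letters-labelled (x ∷ b) c       = cong (x ∷_) (letters-labelled b c)

  select-↭ : ∀ t {T U} → T ↭ U → select t T ↭ select t U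
  select-↭ t σ = map⁺ proj₂ (filter-↭ (λ x → proj₁ x Bool.≟ t) σ)

module _ (p : ℕ) {G : Set} {r : ℕ} (val : G → Fin r → ℤ) where
  open ZeroSums p val
  open Arithmetic zeroSums

  zeroSum? : Decidable ZeroSum
  zeroSum? = labelling? λ T → Fin.all? λ j → + p ∣? coord j T

  atom? : Decidable (Atom B)
  atom? A = zeroSum? A ×-dec (nonempty? A ×-dec ¬? (map′ from to (labelling? split? A)))
    where
    Split : List (Bool × G) → Set
    Split T = B (select true T) × B (select false T) × select true T ≢ [] × select false T ≢ []
    split? : Decidable Split
    split? T = zeroSum? _ ×-dec (zeroSum? _ ×-dec (nonempty? _ ×-dec nonempty? _))
    Factors = Σ (List G) λ b → Σ (List G) λ c → B b × B c × b ≢ [] × c ≢ [] × A ↭ (b ++ c)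
    from : (Σ (List (Bool × G)) λ T → letters T ≡ A × Split T) → Factors
    from (T , refl , b∈B , c∈B , b≢[] , c≢[]) = _ , _ , b∈B , c∈B , b≢[] , c≢[] , select-split T
    to : Factors → Σ (List (Bool × G)) λ T → letters T ≡ A × Split T
    to (b , c , b∈B , c∈B , b≢[] , c≢[] , σ)
      -- The letters are labelled by factor in b ++ c, and the permutation carries the labels over
      -- to the order of A.
      with ↭-map-inv (proj₂ {A = Bool} {B = λ _ → G}) {map (true ,_) b ++ map (false ,_) c} (↭-trans (↭-reflexive (letters-labelled b c)) (↭-sym σ))
    ... | T , refl , τ = T , refl , B-↭ b↭ b∈B , B-↭ c↭ c∈B , nonempty b≢[] b↭ , nonempty c≢[] c↭
      where
      b↭ = ↭-trans (↭-reflexive (sym (proj₁ (select-labelled b c)))) (select-↭ true τ)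
      c↭ = ↭-trans (↭-reflexive (sym (proj₂ (select-labelled b c)))) (select-↭ false τ)
      nonempty : ∀ {xs ys : List G} → xs ≢ [] → xs ↭ ys → ys ≢ []
      nonempty xs≢[] ρ refl = xs≢[] (↭-empty-inv ρ)

module _ (p : ℕ) .{{_ : NonZero p}} where
  open Int using (_+_; _*_; -_; _-_)

  residue : ℤ → Fin p
  residue z = fromℕ< (n%ℕd<d z p)

  residue-cong : ∀ z → + p ∣ + toℕ (residue z) - z
  residue-cong z = divides (- (z /ℕ p)) (begin
    + toℕ (residue z) - z                            ≡⟨ cong (λ n → + n - z) (Fin.toℕ-fromℕ< (n%ℕd<d z p)) ⟩
    + (z %ℕ p) - z                                   ≡⟨ cong (λ w → + (z %ℕ p) - w) (a≡a%ℕn+[a/ℕn]*n z p) ⟩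
    + (z %ℕ p) - (+ (z %ℕ p) + (z /ℕ p) * + p)       ≡⟨ eq (+ (z %ℕ p)) (z /ℕ p) (+ p) ⟩
    - (z /ℕ p) * + p                                 ∎)
    where
    open ≡-Reasoning
    eq : ∀ n q p → n - (n + q * p) ≡ - q * p
    eq = solve-∀

  residue-inj : ∀ z w → residue z ≡ residue w → + p ∣ z - w
  residue-inj z w eq = subst (+ p ∣_) (trans (cong (λ x → + toℕ x - w - (+ toℕ (residue z) - z)) (sym eq)) (arith (+ toℕ (residue z)) z w))
    (∣m∣n⇒∣m-n (residue-cong w) (residue-cong z))
    where
    arith : ∀ n z w → n - w - (n - z) ≡ z - w
    arith = solve-∀

-- Two of the first p + 1 partial sums agree modulo p, so a zero-sum block splits off.
davenport : ∀ p .{{_ : NonZero p}} {G : Set} (val : G → Fin 1 → ℤ) →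
  let open Arithmetic (ZeroSums.zeroSums p val) in ∀ {A} → Atom B A → length A ≤ p
davenport p {G} val {A} ((T , refl , T-zero) , _ , ¬split) with length A ℕ.≤? p
... | yes A≤p = A≤p
... | no  A≰p = ⊥-elim (collide (Fin.pigeonhole ℕ.≤-refl λ i → residue p (partial (toℕ i))))
  where
  open Int using (_+_; _*_; -_; _-_)
  open ZeroSums p val
  p<T : p < length T
  p<T = subst (p <_) (length-map proj₂ T) (ℕ.≰⇒> A≰p)
  partial : ℕ → ℤ
  partial i = coord zero (take i T)
  collide : ¬ (∃₂ λ i j → toℕ i < toℕ j × residue p (partial (toℕ i)) ≡ residue p (partial (toℕ j)))
  collide (i , j , i<j , ri≡rj) = ¬split
    (letters mid , letters (pre ++ post) , (mid , refl , λ { zero → mid-zero }) , (pre ++ post , refl , λ { zero → rest-zero }) ,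
     mid≢[] ∘ letters≡[] , rest≢[] ∘ letters≡[] ,
     ↭-trans (map⁺ proj₂ T↭) (↭-reflexive (map-++ proj₂ mid (pre ++ post))))
    where
    k    = toℕ j Nat.∸ toℕ i
    pre  = take (toℕ i) T
    mid  = take k (drop (toℕ i) T)
    post = drop k (drop (toℕ i) T)
    letters≡[] : ∀ {U : List (Bool × G)} → letters U ≡ [] → U ≡ []
    letters≡[] {[]} _ = refl
    T↭ : T ↭ mid ++ (pre ++ post)
    T↭ = ↭-trans (↭-reflexive (trans (sym (take++drop≡id (toℕ i) T)) (cong (pre ++_) (sym (take++drop≡id k (drop (toℕ i) T))))))
                 (shifts pre mid)
    partial-j : partial (toℕ j) ≡ partial (toℕ i) + coord zero mid
    partial-j = trans (cong (coord zero) (trans (cong (λ n → take n T) (sym (ℕ.m+[n∸m]≡n (ℕ.<⇒≤ i<j)))) (take-+ (toℕ i) k T)))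
                      (total-++ _ pre mid)
    mid-zero : + p ∣ coord zero mid
    mid-zero = subst (+ p ∣_) (trans (cong (_- partial (toℕ i)) partial-j) (eq (partial (toℕ i)) (coord zero mid)))
      (residue-inj p (partial (toℕ j)) (partial (toℕ i)) (sym ri≡rj))
      where
      eq : ∀ x m → x + m - x ≡ m
      eq = solve-∀
    rest-zero : + p ∣ coord zero (pre ++ post)
    rest-zero = ∣m+n∣m⇒∣n (subst (+ p ∣_) (trans (total-↭ _ T↭) (total-++ _ mid (pre ++ post))) (T-zero zero)) mid-zero
    j≤p : toℕ j ≤ p
    j≤p = ℕ.≤-pred (Fin.toℕ<n j)
    mid≢[] : mid ≢ []
    mid≢[] eq = ℕ.<⇒≢ (ℕ.⊓-pres-m< (ℕ.m<n⇒0<n∸m i<j) (ℕ.m<n⇒0<n∸m (ℕ.<-≤-trans i<j (ℕ.≤-trans j≤p (ℕ.<⇒≤ p<T)))))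
      (sym (trans (sym (trans (length-take k _) (cong (k Nat.⊓_) (length-drop (toℕ i) T)))) (cong length eq)))
    -- The block has at most j ≤ p letters, whereas T has more than p.
    rest≢[] : pre ++ post ≢ []
    rest≢[] eq = ℕ.<⇒≱ p<T (begin
      length T                     ≡⟨ ↭-length T↭ ⟩
      length (mid ++ (pre ++ post)) ≡⟨ cong (λ xs → length (mid ++ xs)) eq ⟩
      length (mid ++ [])           ≡⟨ cong length (++-identityʳ mid) ⟩
      length mid                   ≡⟨ length-take k _ ⟩
      k Nat.⊓ _                    ≤⟨ ℕ.m⊓n≤m k _ ⟩
      k                            ≤⟨ ℕ.m∸n≤m (toℕ j) (toℕ i) ⟩
      toℕ j                        ≤⟨ j≤p ⟩
      p                            ∎)
      where open ℕ.≤-Reasoning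

-- Minimal distances over finite alphabets with one coordinate

module _ {G : Set} (elements : List G) (complete : ∀ g → g ∈ elements) where

  sequences≤ : ℕ → List (List G)
  sequences≤ zero    = [] ∷ []
  sequences≤ (suc n) = [] ∷ cartesianProductWith _∷_ elements (sequences≤ n)

  ∈-sequences≤ : ∀ {n A} → length A ≤ n → A ∈ sequences≤ n
  ∈-sequences≤ {zero}  {[]}    _         = here refl
  ∈-sequences≤ {suc n} {[]}    _         = here refl
  ∈-sequences≤ {suc n} {g ∷ A} (s≤s A≤n) = there (∈-cartesianProductWith⁺ _∷_ (complete g) (∈-sequences≤ A≤n))

  module _ (p : ℕ) (p-prime : Prime p) (p≢2 : p ≢ 2) (val : G → Fin 1 → ℤ) where
    open Arithmetic (ZeroSums.zeroSums p val)
    open OddPrime p p-prime p≢2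
    private instance
      p≢0 : NonZero p
      p≢0 = prime⇒nonZero p-prime

    -- Besides minimality, the comparison of a union with its components uses `congr` and `diff`
    -- separately; `∣p-2` makes `D` odd and positive.
    record MinΔ (Q : G → Set) : Set where
      field
        D       : ℕ
        ∣p-2    : D ℕ.∣ p Nat.∸ 2
        congr   : AtomsCongruent Q D
        diff    : Over.LengthDiff Q D

      isMinΔ : IsMinΔ (Over Q) D
      isMinΔ = congruent⇒minΔ (∣p-2⇒>0 ∣p-2) (∣p-2⇒⊥2 ∣p-2) diff congr

    abstract
      -- By `davenport` all atoms occur in the finite list `sequences≤ p`. The gcd of their weights
      -- minus 2 divides each of these numbers, and it is a length difference because each of them
      -- is.
      minΔ-exists : ∀ {Q} → Decidable Q → ∀ {g} → NonzeroLetter g → Q g → MinΔ Q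
      minΔ-exists {Q} Q? {g} g≢0 g∈Q = record { D = D ; ∣p-2 = D∣p-2 ; congr = congr ; diff = gcd-diff (sequences≤ p) }
        where
        open Over Q using (LengthDiff; diff-0; diff-gcd)
        excess : List G → ℕ
        excess A with atom? p val A ×-dec All.all? Q? A
        ... | yes _ = weight A Nat.∸ 2
        -- The value 0 is neutral for the gcd and a length difference of the empty sequence.
        ... | no  _ = 0
        excess-atom : ∀ {A} → Atom B A → Allₗ Q A → excess A ≡ weight A Nat.∸ 2
        excess-atom {A} atom q with atom? p val A ×-dec All.all? Q? A
        ... | yes _ = refl
        ... | no ¬a = contradiction (atom , q) ¬a
        excess-diff : ∀ A → LengthDiff (excess A)
        excess-diff A with atom? p val A ×-dec All.all? Q? A
        ... | yes (atom , q) = atom-diff atom q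
        ... | no  _          = diff-0
        gcds : List (List G) → ℕ
        gcds = foldr (λ A → gcd (excess A)) 0
        gcd-diff : ∀ As → LengthDiff (gcds As)
        gcd-diff []       = diff-0
        gcd-diff (A ∷ As) = diff-gcd (excess-diff A) (gcd-diff As)
        gcd∣ : ∀ {A As} → A ∈ As → gcds As ℕ.∣ excess A
        gcd∣ {A} {_ ∷ As} (here refl) = gcd[m,n]∣m (excess A) (gcds As)
        gcd∣ {A} {B ∷ As} (there A∈)  = ℕ.∣-trans (gcd[m,n]∣n (excess B) (gcds As)) (gcd∣ A∈)
        D : ℕ
        D = gcds (sequences≤ p)
        congr : AtomsCongruent Q D
        congr {A} atom q = subst (D ℕ.∣_) (excess-atom atom q) (gcd∣ {A} (∈-sequences≤ (davenport p val {A} atom)))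
        D∣p-2 : D ℕ.∣ p Nat.∸ 2
        D∣p-2 = congruent⇒∣p-2 val congr g≢0 g∈Q

filter-split : ∀ {A : Set} {P : A → Set} (P? : Decidable P) xs → xs ↭ filter P? xs ++ filter (∁? P?) xs
filter-split P? []       = ↭-refl
filter-split P? (x ∷ xs) with P? x
... | yes _ = prep x (filter-split P? xs)
... | no  _ = ↭-trans (prep x (filter-split P? xs)) (↭-sym (shift x (filter P? xs) _))

funToFin-cong : ∀ {m n} {f g : Fin m → Fin n} → (∀ i → f i ≡ g i) → funToFin f ≡ funToFin g
funToFin-cong {zero}  _   = refl
funToFin-cong {suc m} f≗g = cong₂ combine (f≗g zero) (funToFin-cong (f≗g ∘ suc))

-- Unions of independent lines

module ElementaryAbelian (p : ℕ) (p-prime : Prime p) (p≢2 : p ≢ 2) (r : ℕ) where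
  open Int using (_+_; _*_; -_; _-_)
  open OddPrime p p-prime p≢2

  private instance
    p≢0 : NonZero p
    p≢0 = prime⇒nonZero p-prime

  val₁ : Fin p → Fin 1 → ℤ
  val₁ a _ = + toℕ a

  Group : Set
  Group = Vec (Fin p) r

  val : Group → Fin r → ℤ
  val g j = + toℕ (lookup g j)

  module C₁ = Arithmetic (ZeroSums.zeroSums p val₁)
  open Arithmetic (ZeroSums.zeroSums p val)

  infixr 8 _·_
  _·_ : Fin p → Group → Group
  a · g = Vec.map (λ x → residue p (+ toℕ a * + toℕ x)) g

  ·-val : ∀ a g j → + p ∣ val (a · g) j - + toℕ a * val g j
  ·-val a g j = subst (λ x → + p ∣ + toℕ x - + toℕ a * val g j) (sym (Vec.lookup-map j _ g)) (residue-cong p (+ toℕ a * val g j))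

  toℕ-cong⇒≡ : ∀ (a b : Fin p) → + p ∣ + toℕ a - + toℕ b → a ≡ b
  toℕ-cong⇒≡ a b p∣ = Fin.toℕ-injective (ℤ.+-injective (ℤ.i-j≡0⇒i≡j _ _ (∣-small⇒0 p∣ (ℕ.≤-<-trans
    (subst (λ z → ∣ z ∣ ≤ toℕ a Nat.⊔ toℕ b) (sym (ℤ.m-n≡m⊖n (toℕ a) (toℕ b))) (ℤ.∣m⊝n∣≤m⊔n (toℕ a) (toℕ b)))
    (ℕ.⊔-pres-<m (Fin.toℕ<n a) (Fin.toℕ<n b))))))

  val-cong⇒≡ : ∀ {g h} → (∀ j → + p ∣ val g j - val h j) → g ≡ h
  val-cong⇒≡ {g} {h} p∣ = trans (sym (Vec.tabulate∘lookup g))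
    (trans (Vec.tabulate-cong λ j → toℕ-cong⇒≡ _ _ (p∣ j)) (Vec.tabulate∘lookup h))

  p∤1 : ¬ (+ p ∣ + 1)
  p∤1 p∣1 = ℕ.<⇒≱ 2≤p (ℕ.∣⇒≤ (∣⇒∣ᵤ p∣1))

  -- If gᵢ were zero, the coefficients `δ k i` would give a vanishing combination, and p would
  -- divide 1.
  independent⇒nonzero : ∀ {s} {g : Fin s → Group} → Independent p (λ i → val (g i)) → ∀ i → NonzeroLetter (g i)
  independent⇒nonzero {g = g} indep i gi≡0 = p∤1 (subst (λ n → + p ∣ + n) (δℕ-refl i) (indep (λ k → δ k i)
    (λ j → subst (+ p ∣_) (trans (sym (∑-δ (λ k → val (g k) j) i)) (sum-cong-≗ λ k → ℤ.*-comm (val (g k) j) (δ k i)))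
      (ZeroSums.zero-letter⁻ p val gi≡0 j)) i))

  module Scale {g : Group} (g≢0 : NonzeroLetter g) =
    Coordinates p val₁ val (_· g) (λ _ → val g) (single-independent val g≢0)
      (λ a j → subst (λ w → + p ∣ val (a · g) j - w) (sym (ℤ.+-identityʳ (+ toℕ a * val g j))) (·-val a g j))

  -- Zero letters get an alternative of their own in `cover`: they lie on every line, and as atoms
  -- of weight 2 they impose no condition.
  module Union {s : ℕ} (g : Fin s → Group) (indep : Independent p (λ i → val (g i)))
    {Q : Group → Set} {Qᵢ : Fin s → Fin p → Set}
    (inclusion : ∀ {i a} → Qᵢ i a → Q (a · g i))
    (cover : ∀ {h} → Q h → B (h ∷ []) ⊎ Σ (Fin s) λ i → Σ (Fin p) λ a → Qᵢ i a × h ≡ a · g i) where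

    g≢0 : ∀ i → NonzeroLetter (g i)
    g≢0 = independent⇒nonzero indep

    component-congruent : ∀ {D} → AtomsCongruent Q D → ∀ i → C₁.AtomsCongruent (Qᵢ i) D
    component-congruent congr i = Scale.congruent-pullback (g≢0 i) inclusion congr

    component-diff : ∀ {n} i → C₁.Over.LengthDiff (Qᵢ i) n → Over.LengthDiff Q n
    component-diff i = Scale.diff-map (g≢0 i) inclusion

    private
      -- Letters tagged with their line, so that sorting by lines is possible although different
      -- lines share the zero element.
      Index : Set
      Index = Fin s × Fin p

      γ : Index → Group
      γ (i , a) = a · g i

      valᴵ : Index → Fin s → ℤ
      valᴵ (i , a) k = + toℕ a * δ k i

      γ-val : ∀ x j → + p ∣ val (γ x) j - ∑ (λ k → valᴵ x k * val (g k) j)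
      γ-val (i , a) j = subst (λ w → + p ∣ val (a · g i) j - w)
        (sym (trans (sum-cong-≗ λ k → eq (+ toℕ a) (δ k i) (val (g k) j)) (∑-δ (λ k → + toℕ a * val (g k) j) i)))
        (·-val a (g i) j)
        where
        eq : ∀ a d v → a * d * v ≡ a * v * d
        eq = solve-∀

    open Coordinates p valᴵ val γ (λ i → val (g i)) indep γ-val

    private
      open ZeroSums p valᴵ using (coord)

      InComponent : Fin s → Bool × Index → Set
      InComponent i (_ , i′ , _) = i′ ≡ i

      inComponent? : ∀ i → Decidable (InComponent i)
      inComponent? i (_ , i′ , _) = i′ Fin.≟ i

      -- A letter tagged i′ can have a nonzero coordinate only at i′, so keeping one component acts
      -- on the coordinates as a projection.
      coord-component : ∀ i k T → coord k (filter (inComponent? i) T) ≡ δ k i * coord k T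
      coord-component i k [] = sym (ℤ.*-zeroʳ (δ k i))
      coord-component i k ((t , i′ , a) ∷ T) with i′ Fin.≟ i
      ... | yes refl = trans (addˡ (signed t (+ toℕ a * δ k i)) (coord-component i k T))
                             (idempotent t (+ toℕ a) (coord k T))
        where
        δ²≡δ : δ k i * δ k i ≡ δ k i
        δ²≡δ with k Fin.≟ i
        ... | yes refl rewrite δℕ-refl k = refl
        ... | no  k≢i  rewrite δℕ-≢ k≢i  = refl
        idempotent : ∀ t a c → signed t (a * δ k i) + δ k i * c ≡ δ k i * (signed t (a * δ k i) + c)
        idempotent true  a c = trans (cong (λ d → a * d + δ k i * c) (sym δ²≡δ)) (eq a (δ k i) c)
          where
          eq : ∀ a d c → a * (d * d) + d * c ≡ d * (a * d + c)
          eq = solve-∀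
        idempotent false a c = trans (cong (λ d → - (a * d) + δ k i * c) (sym δ²≡δ)) (eq a (δ k i) c)
          where
          eq : ∀ a d c → - (a * (d * d)) + d * c ≡ d * (- (a * d) + c)
          eq = solve-∀
      ... | no i′≢i = trans (coord-component i k T) (orthogonal t (+ toℕ a) (coord k T))
        where
        δδ≡0 : δ k i * δ k i′ ≡ + 0
        δδ≡0 with k Fin.≟ i
        ... | yes refl rewrite δℕ-≢ (i′≢i ∘ sym) = ℤ.*-zeroʳ (δ k k)
        ... | no  k≢i  rewrite δℕ-≢ k≢i          = refl
        orthogonal : ∀ t a c → δ k i * c ≡ δ k i * (signed t (a * δ k i′) + c)
        orthogonal true  a c = trans (trans (eq₀ a (δ k i) c) (cong (λ z → a * z + δ k i * c) (sym δδ≡0))) (eq a (δ k i) (δ k i′) c)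
          where
          eq₀ : ∀ a d c → d * c ≡ a * + 0 + d * c
          eq₀ = solve-∀
          eq : ∀ a d e c → a * (d * e) + d * c ≡ d * (a * e + c)
          eq = solve-∀
        orthogonal false a c = trans (trans (eq₀ a (δ k i) c) (cong (λ z → - a * z + δ k i * c) (sym δδ≡0))) (eq a (δ k i) (δ k i′) c)
          where
          eq₀ : ∀ a d c → d * c ≡ - a * + 0 + d * c
          eq₀ = solve-∀
          eq : ∀ a d e c → - a * (d * e) + d * c ≡ d * (- (a * e) + c)
          eq = solve-∀

      -- The letters on the line of the first letter have sum zero by themselves, with the given
      -- signs, and so do all the others. In an atom there can be no others.
      index-atom-one-component : ∀ {T} → K.Atom K.B T → Σ (Fin s) λ i → Allₗ (λ x → proj₁ x ≡ i) T
      index-atom-one-component {[]}          (_ , T≢[] , _) = contradiction refl T≢[]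
      index-atom-one-component {(i , a) ∷ _} (((t , i , a) ∷ U , refl , p∣) , _ , ¬split) = i , all-in
        where
        T = (t , i , a) ∷ U
        same  = filter (inComponent? i) T
        other = filter (∁? (inComponent? i)) T
        T↭ : T ↭ same ++ other
        T↭ = filter-split (inComponent? i) T
        same-zero : ∀ k → + p ∣ coord k same
        same-zero k = subst (+ p ∣_) (sym (coord-component i k T)) (∣n⇒∣m*n (δ k i) (p∣ k))
        other-zero : ∀ k → + p ∣ coord k other
        other-zero k = ∣m+n∣m⇒∣n (subst (+ p ∣_) (trans (total-↭ _ T↭) (total-++ _ same other)) (p∣ k)) (same-zero k)
        same≢[] : letters same ≢ []
        same≢[] eq with trans (cong letters (sym (filter-accept (inComponent? i) {t , i , a} {U} refl))) eq
        ... | ()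
        other≡[] : letters other ≡ []
        other≡[] with letters other in eq
        ... | []    = refl
        ... | _ ∷ _ = contradiction
          (letters same , letters other , (same , refl , same-zero) , (other , refl , other-zero) , same≢[] ,
           (λ eq′ → contradiction (trans (sym eq) eq′) λ ()) , ↭-trans (map⁺ proj₂ T↭) (↭-reflexive (map-++ proj₂ same other)))
          ¬split
        all-in : Allₗ (λ x → proj₁ x ≡ i) (letters T)
        all-in = All-resp-↭ (↭-sym (↭-trans (map⁺ proj₂ T↭) (↭-reflexive
            (trans (map-++ proj₂ same other) (trans (cong (letters same ++_) other≡[]) (++-identityʳ (letters same)))))))
          (All.map⁺ (All.all-filter (inComponent? i) T))

      indexed : ∀ {A} → Allₗ NonzeroLetter A → Allₗ Q A →
        Σ (List Index) λ T → A ≡ map γ T × Allₗ (λ x → Qᵢ (proj₁ x) (proj₂ x)) T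
      indexed []         []       = [] , refl , []
      indexed (h≢0 ∷ nz) (q ∷ qs) with cover q | indexed nz qs
      ... | inj₁ h≡0               | _              = contradiction h≡0 h≢0
      ... | inj₂ (i , a , qᵢ , refl) | T , refl , qs′ = (i , a) ∷ T , refl , qᵢ ∷ qs′

      map-component : ∀ {i T} → Allₗ (λ x → proj₁ x ≡ i) T → Allₗ (λ x → Qᵢ (proj₁ x) (proj₂ x)) T →
        map γ T ≡ map (_· g i) (map proj₂ T) × Allₗ (Qᵢ i) (map proj₂ T)
      map-component []            []       = refl , []
      map-component (refl ∷ same) (q ∷ qs) with map-component same qs
      ... | eq , qs′ = cong (_ ∷_) eq , q ∷ qs′

    -- A nonzero atom is tagged, found to lie on one line, and pulled back to an atom over C_p of
    -- the same weight.
    union-congruent : ∀ {D} → (∀ i → C₁.AtomsCongruent (Qᵢ i) D) → AtomsCongruent Q D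
    union-congruent {D} congr {A} atom q with atom-cases atom
    ... | inj₁ (z , z∈B , refl) = subst (λ w → D ℕ.∣ w Nat.∸ 2) (sym (weight-zero z∈B)) (D ℕ.∣0)
    ... | inj₂ nz with indexed nz q
    ...   | T , refl , qs with index-atom-one-component (atom-unmap {T} atom)
    ...     | i , same with map-component same qs
    ...       | eq , qs′ = subst (λ w → D ℕ.∣ w Nat.∸ 2)
      (trans (sym (S.weight-map (map proj₂ T))) (cong weight (sym eq)))
      (congr i (S.atom-unmap {map proj₂ T} (subst (Atom B) eq atom)) qs′)
      where module S = Scale (g≢0 i)

-- Decomposition of a support into independent lines

module Bases (p : ℕ) (p-prime : Prime p) (p≢2 : p ≢ 2) (r : ℕ) where
  open Int using (_+_; _*_; -_; _-_)
  open OddPrime p p-prime p≢2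
  open ElementaryAbelian p p-prime p≢2 r
  open Arithmetic (ZeroSums.zeroSums p val)

  private instance
    p≢0 : NonZero p
    p≢0 = prime⇒nonZero p-prime

  inverse : ∀ c → ¬ (+ p ∣ c) → Σ ℤ λ e → + p ∣ e * c - + 1
  inverse c p∤c = signed-inverse (coprime-Bézout c⊥p)
    where
    c⊥p : Coprime ∣ c ∣ p
    c⊥p (i∣c , i∣p) with prime⇒irreducible p-prime i∣p
    ... | inj₁ i≡1  = i≡1
    ... | inj₂ refl = contradiction (∣ᵤ⇒∣ i∣c) p∤c
    bezout : Bézout.Identity 1 ∣ c ∣ p → Σ ℤ λ e → + p ∣ e * + ∣ c ∣ - + 1
    bezout (Bézout.+- x y eq) = + x , divides (+ y) (begin
      + x * + ∣ c ∣ - + 1      ≡⟨ cong (_- + 1) (ℤ.pos-* x ∣ c ∣) ⟨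
      + (x Nat.* ∣ c ∣) - + 1  ≡⟨ cong (λ n → + n - + 1) eq ⟨
      + 1 + + (y Nat.* p) - + 1 ≡⟨ cong (λ z → + 1 + z - + 1) (ℤ.pos-* y p) ⟩
      + 1 + + y * + p - + 1    ≡⟨ arith (+ y * + p) ⟩
      + y * + p                ∎)
      where
      open ≡-Reasoning
      arith : ∀ z → + 1 + z - + 1 ≡ z
      arith = solve-∀
    bezout (Bézout.-+ x y eq) = - + x , divides (- + y) (begin
      - + x * + ∣ c ∣ - + 1          ≡⟨ arith (+ x) (+ ∣ c ∣) ⟩
      - (+ 1 + + x * + ∣ c ∣)        ≡⟨ cong (λ z → - (+ 1 + z)) (ℤ.pos-* x ∣ c ∣) ⟨
      - (+ 1 + + (x Nat.* ∣ c ∣))    ≡⟨ cong (λ n → - (+ n)) eq ⟩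
      - + (y Nat.* p)                ≡⟨ cong -_ (ℤ.pos-* y p) ⟩
      - (+ y * + p)                  ≡⟨ ℤ.neg-distribˡ-* (+ y) (+ p) ⟩
      - + y * + p                    ∎)
      where
      open ≡-Reasoning
      arith : ∀ x c → - x * c - + 1 ≡ - (+ 1 + x * c)
      arith = solve-∀
    signed-inverse : Bézout.Identity 1 ∣ c ∣ p → Σ ℤ λ e → + p ∣ e * c - + 1
    signed-inverse id with ℤ.+∣i∣≡i⊎+∣i∣≡-i c | bezout id
    ... | inj₁ ∣c∣≡c  | e , p∣ = e , subst (λ z → + p ∣ e * z - + 1) ∣c∣≡c p∣
    ... | inj₂ ∣c∣≡-c | e , p∣ = - e , subst (λ z → + p ∣ z - + 1) (trans (cong (λ z → e * z) ∣c∣≡-c) (eq e c)) p∣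
      where
      eq : ∀ e c → e * - c ≡ - e * c
      eq = solve-∀

  one : Fin p
  one = residue p (+ 1)

  one-· : ∀ h → one · h ≡ h
  one-· h = val-cong⇒≡ λ j → subst (+ p ∣_) (eq (val (one · h) j) (+ toℕ one) (val h j))
    (∣m∣n⇒∣m+n (·-val one h j) (∣m⇒∣m*n (val h j) (residue-cong p (+ 1))))
    where
    eq : ∀ w o v → w - o * v + (o - + 1) * v ≡ w - v
    eq = solve-∀

  combination : ∀ {s} → (Fin s → ℤ) → (Fin s → Group) → Fin r → ℤ
  combination c g j = ∑ (λ i → c i * val (g i) j)

  combination-∸ : ∀ {s} (c c′ : Fin s → ℤ) (g : Fin s → Group) j →
    combination (λ i → c i - c′ i) g j ≡ combination c g j - combination c′ g j
  combination-∸ c c′ g j = trans (cancel (combination (λ i → c i - c′ i) g j) (combination c′ g j))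
    (cong (_- combination c′ g j) (trans
      (sym (∑-distrib-+ (λ i → (c i - c′ i) * val (g i) j) (λ i → c′ i * val (g i) j)))
      (sum-cong-≗ λ i → arith (c i) (c′ i) (val (g i) j))))
    where
    arith : ∀ x y v → (x - y) * v + y * v ≡ x * v
    arith = solve-∀
    cancel : ∀ a b → a ≡ a + b - b
    cancel = solve-∀

  combination-mod : ∀ {s} (c c′ : Fin s → ℤ) (g : Fin s → Group) → (∀ i → + p ∣ c i - c′ i) →
    ∀ j → + p ∣ combination c g j - combination c′ g j
  combination-mod c c′ g c≡c′ j = subst (+ p ∣_) (combination-∸ c c′ g j) (∣-∑ λ i → ∣m⇒∣m*n (val (g i) j) (c≡c′ i))

  -- Distinct coefficient vectors with entries in `Fin p` have distinct combinations, so p^s ≤ p^r.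
  independent⇒≤ : ∀ {s} (g : Fin s → Group) → Independent p (λ i → val (g i)) → s ≤ r
  independent⇒≤ {s} g indep = ℕ.≮⇒≥ λ r<s → ℕ.<⇒≱ (ℕ.^-monoʳ-< p 2≤p r<s) (Fin.injective⇒≤ evaluate-injective)
    where
    coefficients : Fin (p Nat.^ s) → Fin s → ℤ
    coefficients k i = + toℕ (finToFun k i)
    evaluate : Fin (p Nat.^ s) → Fin (p Nat.^ r)
    evaluate k = funToFin λ j → residue p (combination (coefficients k) g j)
    evaluate-injective : ∀ {k l} → evaluate k ≡ evaluate l → k ≡ l
    evaluate-injective {k} {l} eq = begin
      k                             ≡⟨ Fin.funToFin-finToFin {s} k ⟨
      funToFin (finToFun {p} {s} k) ≡⟨ funToFin-cong same ⟩
      funToFin (finToFun {p} {s} l) ≡⟨ Fin.funToFin-finToFin {s} l ⟩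
      l                             ∎
      where
      open ≡-Reasoning
      residues : ∀ j → + p ∣ combination (coefficients k) g j - combination (coefficients l) g j
      residues j = residue-inj p (combination (coefficients k) g j) (combination (coefficients l) g j)
        (trans (sym (Fin.finToFun-funToFin (λ j → residue p (combination (coefficients k) g j)) j))
          (trans (cong (λ n → finToFun n j) eq) (Fin.finToFun-funToFin (λ j → residue p (combination (coefficients l) g j)) j)))
      same : ∀ i → finToFun {p} {s} k i ≡ finToFun l i
      same i = toℕ-cong⇒≡ _ _ (indep (λ i → coefficients k i - coefficients l i)
        (λ j → subst (+ p ∣_) (sym (combination-∸ (coefficients k) (coefficients l) g j)) (residues j)) i)

  module _ {s : ℕ} (g : Fin s → Group) where

    InSpan : Group → (Fin s → Fin p) → Set
    InSpan h x = ∀ j → + p ∣ val h j - combination (λ i → + toℕ (x i)) g j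

    inSpan? : ∀ h → Dec (Σ (Fin s → Fin p) (InSpan h))
    inSpan? h = map′ (λ (k , h≡) → finToFun k , h≡)
      (λ (x , h≡) → funToFin x , λ j → subst (λ w → + p ∣ val h j - w)
        (sum-cong-≗ λ i → cong (λ a → + toℕ a * val (g i) j) (sym (Fin.finToFun-funToFin x i))) (h≡ j))
      (Fin.any? {p Nat.^ s} λ k → Fin.all? λ j → + p ∣? (val h j - combination (λ i → + toℕ (finToFun k i)) g j))

    extend : Group → Fin (suc s) → Group
    extend h zero    = h
    extend h (suc i) = g i

    -- A relation whose coefficient c₀ at h is prime to p can be solved for h: with e inverse to c₀
    -- modulo p, the coefficients -e cᵢ put h into the span.
    extend-independent : ∀ {h} → Independent p (λ i → val (g i)) → ¬ Σ (Fin s → Fin p) (InSpan h) →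
      Independent p (λ i → val (extend h i))
    extend-independent {h} indep h∉span c p∣ with + p ∣? c zero
    ... | yes p∣c₀ = λ { zero → p∣c₀ ; (suc i) → indep (c ∘ suc) (λ j → ∣m+n∣m⇒∣n (p∣ j) (∣m⇒∣m*n (val h j) p∣c₀)) i }
    ... | no  p∤c₀ with inverse (c zero) p∤c₀
    ...   | e , p∣ec₀-1 = contradiction (x , inSpan) h∉span
      where
      d : Fin s → ℤ
      d i = - e * c (suc i)
      x : Fin s → Fin p
      x i = residue p (d i)
      solved : ∀ j → + p ∣ val h j - combination d g j
      solved j = subst (+ p ∣_) (trans (eq e (c zero) (val h j) (combination (c ∘ suc) g j)) (cong (λ z → val h j - z) (sym d≡)))
        (∣m∣n⇒∣m-n (∣n⇒∣m*n e (p∣ j)) (∣m⇒∣m*n (val h j) p∣ec₀-1))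
        where
        eq : ∀ e c h z → e * (c * h + z) - (e * c - + 1) * h ≡ h - - e * z
        eq = solve-∀
        assoc : ∀ e c v → - e * c * v ≡ - e * (c * v)
        assoc = solve-∀
        d≡ : combination d g j ≡ - e * combination (c ∘ suc) g j
        d≡ = trans (sum-cong-≗ λ i → assoc e (c (suc i)) (val (g i) j))
                   (sym (*-distribˡ-sum (- e) (λ i → c (suc i) * val (g i) j)))
      inSpan : InSpan h x
      inSpan j = subst (+ p ∣_) (eq (val h j) (combination d g j) (combination (λ i → + toℕ (x i)) g j))
        (∣m∣n⇒∣m-n (solved j) (combination-mod (λ i → + toℕ (x i)) d g (λ i → residue-cong p (d i)) j))
        where
        eq : ∀ h a b → h - a - (b - a) ≡ h - b
        eq = solve-∀

    OnAxis : Group → Set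
    OnAxis h = B (h ∷ []) ⊎ Σ (Fin s) λ i → Σ (Fin p) λ a → h ≡ a · g i

    span-cases : ∀ {h} x → InSpan h x →
      OnAxis h ⊎ (Σ (Fin s) λ i → Σ (Fin s) λ j → i ≢ j × toℕ (x i) ≢ 0 × toℕ (x j) ≢ 0)
    span-cases {h} x h≡ with Fin.any? (λ i → ¬? (toℕ (x i) ℕ.≟ 0))
    ... | no  x≡0 = inj₁ (inj₁ (ZeroSums.zero-letter⁺ p val λ j → ∣-resp-- (h≡ j) (∣-∑ λ i →
      subst (λ n → + p ∣ + n * val (g i) j) (sym (zero-coefficient i)) (divides (+ 0) refl))))
      where
      zero-coefficient : ∀ i → toℕ (x i) ≡ 0
      zero-coefficient i with toℕ (x i) ℕ.≟ 0
      ... | yes eq = eq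
      ... | no  ≢0 = contradiction (i , ≢0) x≡0
    ... | yes (i , xi≢0) with Fin.any? (λ j → ¬? (i Fin.≟ j) ×-dec ¬? (toℕ (x j) ℕ.≟ 0))
    ...   | yes (j , i≢j , xj≢0) = inj₂ (i , j , i≢j , xi≢0 , xj≢0)
    ...   | no  others≡0         = inj₁ (inj₂ (i , x i , val-cong⇒≡ λ j → subst (+ p ∣_)
      (eq (val h j) (+ toℕ (x i) * val (g i) j) (val (x i · g i) j))
      (∣m∣n⇒∣m-n (subst (λ w → + p ∣ val h j - w) (single j) (h≡ j)) (·-val (x i) (g i) j))))
      where
      eq : ∀ h a v → h - a - (v - a) ≡ h - v
      eq = solve-∀
      zero-coefficient : ∀ {k} → k ≢ i → toℕ (x k) ≡ 0
      zero-coefficient {k} k≢i with toℕ (x k) ℕ.≟ 0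
      ... | yes eq = eq
      ... | no  ≢0 = contradiction (k , k≢i ∘ sym , ≢0) others≡0
      pointwise : ∀ j k → + toℕ (x k) * val (g k) j ≡ + toℕ (x k) * val (g k) j * δ k i
      pointwise j k with k Fin.≟ i
      ... | yes refl rewrite δℕ-refl k = sym (ℤ.*-identityʳ (+ toℕ (x k) * val (g k) j))
      ... | no  k≢i  rewrite zero-coefficient k≢i = refl
      single : ∀ j → combination (λ k → + toℕ (x k)) g j ≡ + toℕ (x i) * val (g i) j
      single j = trans (sum-cong-≗ (pointwise j)) (∑-δ (λ k → + toℕ (x k) * val (g k) j) i)

  record AxisDecomposition (Q : Group → Set) (L : List Group) : Set where
    field
      s     : ℕ
      g     : Fin s → Group
      indep : Independent p (λ i → val (g i))
      g∈Q   : ∀ i → Q (g i)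
      cover : Allₗ (OnAxis g) L

  module _ {Q : Group → Set} {D : ℕ} (congr : AtomsCongruent Q D) (D∣p-2 : D ℕ.∣ p Nat.∸ 2) where

    -- A maximal independent family is chosen greedily from the list. An element outside the current
    -- span joins the family, and whatever was on an axis before stays there; an element inside the
    -- span is on an axis or has two nonzero coordinates.
    axes-or-1 : ∀ {L} → Allₗ Q L → AxisDecomposition Q L ⊎ D ≡ 1
    axes-or-1 [] = inj₁ (record { s = 0 ; g = λ () ; indep = λ _ _ () ; g∈Q = λ () ; cover = [] })
    axes-or-1 {h ∷ L} (h∈Q ∷ L⊆Q) with axes-or-1 L⊆Q
    ... | inj₂ D≡1 = inj₂ D≡1
    ... | inj₁ axes with inSpan? (AxisDecomposition.g axes) h
    ...   | no h∉span = inj₁ (record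
      { s = suc s ; g = extend g h ; indep = extend-independent g {h} indep h∉span
      ; g∈Q = λ { zero → h∈Q ; (suc i) → g∈Q i }
      ; cover = inj₂ (zero , one , sym (one-· h)) ∷ All.map weaken cover })
      where
      open AxisDecomposition axes
      weaken : ∀ {h′} → OnAxis g h′ → OnAxis (extend g h) h′
      weaken (inj₁ h′≡0)         = inj₁ h′≡0
      weaken (inj₂ (i , a , eq)) = inj₂ (suc i , a , eq)
    ...   | yes (x , h≡) with span-cases (AxisDecomposition.g axes) {h} x h≡
    ...     | inj₁ onAxis = inj₁ (record
      { s = s ; g = g ; indep = indep ; g∈Q = g∈Q ; cover = onAxis ∷ cover })
      where open AxisDecomposition axes
    ...     | inj₂ (i , j , i≢j , xi≢0 , xj≢0) =
      inj₂ (two-coordinates⇒1 val g indep g∈Q {h} h∈Q x h≡ i≢j xi≢0 xj≢0 congr D∣p-2)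
      where open AxisDecomposition axes

-- Translation to the signed sums of the statement

module _ {G : Set} where
  open Seqs {G}

  divClosed-resp : ∀ {H H′ : Seq → Set} → (∀ {a} → H a → H′ a) → (∀ {a} → H′ a → H a) →
    ∀ {S} → DivClosedSubmonoid H S → DivClosedSubmonoid H′ S
  divClosed-resp to from (S⊆H , S-[] , S-++ , S-div) =
    (λ a a∈S → to (S⊆H a a∈S)) , S-[] , S-++ , λ s a s∈S a∈H′ (b , b∈H′ , σ) → S-div s a s∈S (from a∈H′) (b , from b∈H′ , σ)

-- The operations reduce representatives and so agree with integer arithmetic only modulo p; `val-0`
-- turns a final congruence back into an equality in the group.
module SignedSums (p : ℕ) {G : Set} {r : ℕ} (val : G → Fin r → ℤ) (_⊕_ : G → G → G) (⊖_ : G → G) (𝟘 : G)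
  (⊕-val : ∀ g h j → + p ∣ val (g ⊕ h) j ℤ.- (val g j ℤ.+ val h j))
  (⊖-val : ∀ g j → + p ∣ val (⊖ g) j ℤ.+ val g j)
  (𝟘-val : ∀ j → + p ∣ val 𝟘 j)
  (val-0 : ∀ {g} → (∀ j → + p ∣ val g j) → g ≡ 𝟘) where
  open Int using (_+_; _*_; -_; _-_)
  open PlusMinus _⊕_ ⊖_ 𝟘
  open ZeroSums p val

  attach : (S : List G) → Vec Bool (length S) → List (Bool × G)
  attach []      []      = []
  attach (g ∷ S) (t ∷ ε) = (t , g) ∷ attach S ε

  letters-attach : ∀ S ε → letters (attach S ε) ≡ S
  letters-attach []      []      = refl
  letters-attach (g ∷ S) (t ∷ ε) = cong (g ∷_) (letters-attach S ε)

  signedSum-val : ∀ S ε j → + p ∣ val (signedSum S ε) j - coord j (attach S ε)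
  signedSum-val []      []          j = subst (+ p ∣_) (sym (ℤ.+-identityʳ _)) (𝟘-val j)
  signedSum-val (g ∷ S) (true  ∷ ε) j = subst (+ p ∣_)
    (eq (val (g ⊕ signedSum S ε) j) (val g j) (val (signedSum S ε) j) (coord j (attach S ε)))
    (∣m∣n⇒∣m+n (⊕-val g (signedSum S ε) j) (signedSum-val S ε j))
    where
    eq : ∀ x g v c → x - (g + v) + (v - c) ≡ x - (g + c)
    eq = solve-∀
  signedSum-val (g ∷ S) (false ∷ ε) j = subst (+ p ∣_)
    (eq (val ((⊖ g) ⊕ signedSum S ε) j) (val g j) (val (⊖ g) j) (val (signedSum S ε) j) (coord j (attach S ε)))
    (∣m∣n⇒∣m+n (∣m∣n⇒∣m+n (⊕-val (⊖ g) (signedSum S ε) j) (⊖-val g j)) (signedSum-val S ε j))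
    where
    eq : ∀ x g n v c → x - (n + v) + (n + g) + (v - c) ≡ x - (- g + c)
    eq = solve-∀

  B±⇒zeroSum : ∀ {S} → B± S → ZeroSum S
  B±⇒zeroSum {S} (ε , sum≡𝟘) = attach S ε , letters-attach S ε , λ j →
    ∣-resp-- (∣-flip (val (signedSum S ε) j) (coord j (attach S ε)) (signedSum-val S ε j))
             (subst (λ g → + p ∣ val g j) (sym sum≡𝟘) (𝟘-val j))

  zeroSum⇒B± : ∀ {S} → ZeroSum S → B± S
  zeroSum⇒B± (T , refl , p∣) = signs T , val-0 λ j →
    ∣-resp-- (signedSum-val (letters T) (signs T) j) (subst (λ U → + p ∣ coord j U) (sym (attach-signs T)) (p∣ j))
    where
    signs : ∀ T → Vec Bool (length (letters T))
    signs []            = []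
    signs ((t , _) ∷ T) = t ∷ signs T
    attach-signs : ∀ T → attach (letters T) (signs T) ≡ T
    attach-signs []      = refl
    attach-signs (x ∷ T) = cong (x ∷_) (attach-signs T)

gcdVec∣lookup : ∀ {r} (ds : Vec ℕ r) j → gcdVec ds ℕ.∣ lookup ds j
gcdVec∣lookup (d ∷ ds) zero    = gcd[m,n]∣m d (gcdVec ds)
gcdVec∣lookup (d ∷ ds) (suc j) = ℕ.∣-trans (gcd[m,n]∣n d (gcdVec ds)) (gcdVec∣lookup ds j)

gcdVec-greatest : ∀ {r c} (ds : Vec ℕ r) → (∀ j → c ℕ.∣ lookup ds j) → c ℕ.∣ gcdVec ds
gcdVec-greatest []       _  = _ ℕ.∣0
gcdVec-greatest (d ∷ ds) c∣ = gcd-greatest (c∣ zero) (gcdVec-greatest ds (c∣ ∘ suc))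

module _ {G : Set} (M : SignedMonoid G) where
  open Arithmetic M

  -- If all letters were zero, every D would divide all length differences.
  nonzero-in-support : ∀ {L d} → IsMinΔ (Over (_∈ L)) d → Σ G λ g → NonzeroLetter g × g ∈ L
  nonzero-in-support {L} {d} isMin with Any.any? (λ g → ¬? (zero? g)) L
  ... | yes found = let g , g∈L , g≢0 = find found in g , g≢0 , g∈L
  ... | no  none  = contradiction
    (ℕ.∣⇒≤ {{ℕ.>-nonZero 0<d}} (congruent⇒∣diff D⊥2 congr (minΔ-diff isMin)))
    (ℕ.<⇒≱ (s≤s (ℕ.m≤m+n d (d Nat.+ 0))))
    where
    open Over (_∈ L) using (minΔ-diff; 0<minΔ)
    0<d : 0 < d
    0<d = 0<minΔ isMin
    -- Odd and larger than d, so it cannot divide the positive difference d.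
    D = suc (2 Nat.* d)
    D⊥2 : Coprime D 2
    D⊥2 {i} (i∣D , i∣2) = ℕ.∣1⇒≡1 (ℕ.∣m+n∣m⇒∣n (subst (i ℕ.∣_) (ℕ.+-comm 1 (2 Nat.* d)) i∣D) (ℕ.∣m⇒∣m*n d i∣2))
    congr : AtomsCongruent (_∈ L) D
    congr {A} atom q with atom-cases atom
    ... | inj₁ (z , z∈B , refl) = subst (λ w → D ℕ.∣ w Nat.∸ 2) (sym (weight-zero z∈B)) (D ℕ.∣0)
    congr {[]}    atom q         | inj₂ _          = contradiction refl (proj₁ (proj₂ atom))
    congr {g ∷ A} atom (g∈L ∷ _) | inj₂ (g≢0 ∷ _) = contradiction (Any.map (λ { refl → g≢0 }) g∈L) none

-- The two inclusions

module OddPrimeΔ (p : ℕ) (p-prime : Prime p) (p≢2 : p ≢ 2) where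
  open Int using (_+_; _*_; -_; _-_)
  open OddPrime p p-prime p≢2

  private instance
    p≢0 : NonZero p
    p≢0 = prime⇒nonZero p-prime

  toℕ-0 : ∀ {a : Fin p} → + p ∣ + toℕ a → toℕ a ≡ 0
  toℕ-0 {a} p∣ = ℤ.+-injective (∣-small⇒0 p∣ (Fin.toℕ<n a))

  +p-val : ∀ a b → + p ∣ + toℕ (_+p_ p a b) - (+ toℕ a + + toℕ b)
  +p-val a b = residue-cong p (+ (toℕ a Nat.+ toℕ b))

  -p-val : ∀ a → + p ∣ + toℕ (-p_ p a) + + toℕ a
  -p-val a = subst (+ p ∣_)
    (trans (cong (λ w → + toℕ (-p_ p a) - w + + p) (+∸ (ℕ.<⇒≤ (Fin.toℕ<n a)))) (eq (+ toℕ (-p_ p a)) (+ p) (+ toℕ a)))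
    (∣m∣n⇒∣m+n (residue-cong p (+ (p Nat.∸ toℕ a))) (divides (+ 1) (sym (ℤ.*-identityˡ (+ p)))))
    where
    eq : ∀ x p a → x - (p - a) + p ≡ x + a
    eq = solve-∀

  0p-val : + p ∣ + toℕ (0p p)
  0p-val = subst (+ p ∣_) (ℤ.+-identityʳ _) (residue-cong p (+ 0))

  val-0p : ∀ {a} → + p ∣ + toℕ a → a ≡ 0p p
  val-0p {a} p∣ = Fin.toℕ-injective (trans (toℕ-0 {a} p∣) (sym (toℕ-0 {0p p} 0p-val)))

  module _ (r : ℕ) where
    open ElementaryAbelian p p-prime p≢2 r
    open Bases p p-prime p≢2 r
    open Arithmetic (ZeroSums.zeroSums p val)

    module Cp = SignedSums p val₁ (_+p_ p) (-p_ p) (0p p) (λ a b _ → +p-val a b) (λ a _ → -p-val a) (λ _ → 0p-val)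
      (λ p∣ → val-0p (p∣ zero))

    module Cpr = SignedSums p val (_+pr_ p) (-pr_ p) (0pr p r)
      (λ g h j → subst (λ x → + p ∣ + toℕ x - (val g j + val h j)) (sym (Vec.lookup-zipWith (_+p_ p) j g h)) (+p-val (lookup g j) (lookup h j)))
      (λ g j → subst (λ x → + p ∣ + toℕ x + val g j) (sym (Vec.lookup-map j (-p_ p) g)) (-p-val (lookup g j)))
      (λ j → subst (λ x → + p ∣ + toℕ x) (sym (Vec.lookup-replicate j (0p p))) 0p-val)
      (λ {g} p∣ → trans (sym (Vec.tabulate∘lookup g)) (trans (Vec.tabulate-cong λ j →
        trans (val-0p (p∣ j)) (sym (Vec.lookup-replicate j (0p p)))) (Vec.tabulate∘lookup (0pr p r))))

    IsMinΔ₁ : (Fin p → Set) → ℕ → Set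
    IsMinΔ₁ Q = Seqs.IsMinΔ (C₁.Over Q)

    one≢0 : C₁.NonzeroLetter one
    one≢0 one∈B = p∤1 (subst (+ p ∣_) (eq (+ toℕ one) (+ 1))
      (∣m∣n⇒∣m-n (ZeroSums.zero-letter⁻ p val₁ one∈B zero) (residue-cong p (+ 1))))
      where
      eq : ∀ x y → x - (x - y) ≡ y
      eq = solve-∀

    minΔ₁ : ∀ {Q : Fin p → Set} → Decidable Q → Q one → MinΔ (allFin p) ∈-allFin p p-prime p≢2 val₁ Q
    minΔ₁ Q? = minΔ-exists (allFin p) ∈-allFin p p-prime p≢2 val₁ Q? one≢0

    inΔ*₁ : ∀ {Q d} → IsMinΔ₁ Q d → Seqs.InΔ* (B±Cp p) d
    inΔ*₁ {Q} isMin = C₁.Over Q , divClosed-resp Cp.zeroSum⇒B± Cp.B±⇒zeroSum (C₁.over-divClosed Q) , isMin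

    -- Over all of C_p there is the atom of length 3 formed by 2g, g and g, which forces D ∣ 1.
    1∈Δ*₁ : Seqs.InΔ* (B±Cp p) 1
    1∈Δ*₁ = inΔ*₁ (subst (IsMinΔ₁ (λ _ → ⊤)) D≡1 isMinΔ)
      where
      open MinΔ (minΔ₁ {λ _ → ⊤} (λ _ → yes tt) tt)
      two : Fin p
      two = residue p (+ 2)
      two-val : ∀ (j : Fin 1) → + p ∣ val₁ two j - + 2 * val₁ one j
      two-val _ = subst (+ p ∣_) (eq (+ toℕ two) (+ toℕ one))
        (∣m∣n⇒∣m-n (residue-cong p (+ 2)) (∣n⇒∣m*n (+ 2) (residue-cong p (+ 1))))
        where
        eq : ∀ t o → t - + 2 - + 2 * (o - + 1) ≡ t - + 2 * o
        eq = solve-∀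
      D≡1 : D ≡ 1
      D≡1 = ℕ.∣1⇒≡1 (multiple-congruent val₁ {λ _ → ⊤} {D} {one} {two} 2 congr one≢0 tt tt two-val (s≤s z≤n) 2<p)

    module Components {L : List Group} {d : ℕ} (isMin : IsMinΔ (Over (_∈ L)) d) {h : Group} (h≢0 : NonzeroLetter h) (h∈L : h ∈ L)
      (d∣p-2 : d ℕ.∣ p Nat.∸ 2) (axes : AxisDecomposition (_∈ L) L) where
      open AxisDecomposition axes
      open DecMembership {A = Group} (Vec.≡-dec Fin._≟_) using (_∈?_)
      Qᵢ : Fin s → Fin p → Set
      Qᵢ i a = a · g i ∈ L
      component : ∀ i → MinΔ (allFin p) ∈-allFin p p-prime p≢2 val₁ (Qᵢ i)
      component i = minΔ₁ (λ a → a · g i ∈? L) (subst (_∈ L) (sym (one-· (g i))) (g∈Q i))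
      module Component i = MinΔ (component i)
      onAxis : ∀ {h} → h ∈ L → OnAxis g h
      onAxis = All.lookup cover
      cover-Q : ∀ {h} → h ∈ L → B (h ∷ []) ⊎ Σ (Fin s) λ i → Σ (Fin p) λ a → Qᵢ i a × h ≡ a · g i
      cover-Q h∈L with onAxis h∈L
      ... | inj₁ h≡0            = inj₁ h≡0
      ... | inj₂ (i , a , refl) = inj₂ (i , a , h∈L , refl)
      module U = Union g indep {_∈ L} {Qᵢ} (λ a·g∈L → a·g∈L) cover-Q
      -- The nonzero letter of L lies on an axis, so there is at least one component.
      i₀ : Fin s
      i₀ with onAxis h∈L
      ... | inj₁ h≡0     = contradiction h≡0 h≢0
      ... | inj₂ (i , _) = i
      s≤r : s ≤ r
      s≤r = independent⇒≤ g indep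
      -- When there are fewer than r components, the remaining entries repeat the one at `i₀`, which
      -- does not affect the gcd.
      pad : ∀ j → Dec (j < s) → ℕ
      pad j (yes j<s) = Component.D (fromℕ< j<s)
      pad j (no  _)   = Component.D i₀
      pad-∈ : ∀ (j : Fin r) j<s? → Seqs.InΔ* (B±Cp p) (pad (toℕ j) j<s?)
      pad-∈ j (yes j<s) = inΔ*₁ (Component.isMinΔ (fromℕ< j<s))
      pad-∈ j (no  _)   = inΔ*₁ (Component.isMinΔ i₀)
      ds : Vec ℕ r
      ds = Vec.tabulate λ j → pad (toℕ j) (toℕ j ℕ.<? s)
      pad-hit : ∀ i j j<s? → j ≡ toℕ i → pad j j<s? ≡ Component.D i
      pad-hit i _ (yes j<s) refl = cong Component.D (Fin.fromℕ<-toℕ i j<s)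
      pad-hit i _ (no  j≮s) refl = contradiction (Fin.toℕ<n i) j≮s
      gcd∣component : ∀ i → gcdVec ds ℕ.∣ Component.D i
      gcd∣component i = subst (gcdVec ds ℕ.∣_)
        (trans (Vec.lookup∘tabulate (λ j → pad (toℕ j) (toℕ j ℕ.<? s)) j) (pad-hit i (toℕ j) (toℕ j ℕ.<? s) (Fin.toℕ-inject≤ i s≤r)))
        (gcdVec∣lookup ds j)
        where
        j : Fin r
        j = inject≤ i s≤r
      ds∈Δ* : All (Seqs.InΔ* (B±Cp p)) ds
      ds∈Δ* = VecAll.tabulate⁺ (λ j → pad-∈ j (toℕ j ℕ.<? s))
      -- Every atom over L of nonzero letters lies on one line, so the gcd of the line distances
      -- divides all length differences over L, among them d.
      gcd∣d : gcdVec ds ℕ.∣ d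
      gcd∣d = congruent⇒∣diff (∣p-2⇒⊥2 (ℕ.∣-trans (gcd∣component i₀) (Component.∣p-2 i₀)))
        (U.union-congruent λ i atom q → ℕ.∣-trans (gcd∣component i) (Component.congr i atom q))
        (Over.minΔ-diff (_∈ L) isMin)
      -- The congruence for atoms over L restricts to each line, so d divides the length differences
      -- there, in particular the minimal distance.
      d∣component : ∀ i → d ℕ.∣ Component.D i
      d∣component i = C₁.congruent⇒∣diff (∣p-2⇒⊥2 d∣p-2) (U.component-congruent (minΔ⇒congruent isMin) i) (Component.diff i)
      d∣gcd : d ℕ.∣ gcdVec ds
      d∣gcd = gcdVec-greatest ds λ j → subst (d ℕ.∣_)
        (sym (Vec.lookup∘tabulate (λ j → pad (toℕ j) (toℕ j ℕ.<? s)) j)) (d∣pad (toℕ j) (toℕ j ℕ.<? s))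
        where
        d∣pad : ∀ j j<s? → d ℕ.∣ pad j j<s?
        d∣pad j (yes j<s) = d∣component (fromℕ< j<s)
        d∣pad j (no  _)   = d∣component i₀

    Δ*-forward : 1 ≤ r → ∀ {d} → Seqs.InΔ* (B±Cpr p r) d →
      Σ (Vec ℕ r) λ ds → All (Seqs.InΔ* (B±Cp p)) ds × gcdVec ds ≡ d
    Δ*-forward 1≤r {d} (S , divClosed , isMin-S) =
      let L , isMin = restrict-to-support (divClosed-resp Cpr.B±⇒zeroSum Cpr.zeroSum⇒B± divClosed) isMin-S
          h , h≢0 , h∈L = nonzero-in-support (ZeroSums.zeroSums p val) isMin
      in fromSupport isMin h≢0 h∈L
      where
      Goal = Σ (Vec ℕ r) λ ds → All (Seqs.InΔ* (B±Cp p)) ds × gcdVec ds ≡ d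
      -- For an empty vector the gcd would be 0.
      ones : ∀ {r} → 1 ≤ r → gcdVec (Vec.tabulate {n = r} (λ _ → 1)) ≡ 1
      ones (s≤s {n = r} _) = gcd-zeroˡ (gcdVec (Vec.tabulate {n = r} (λ _ → 1)))
      fromSupport : ∀ {L} → IsMinΔ (Over (_∈ L)) d → ∀ {h} → NonzeroLetter h → h ∈ L → Goal
      fromSupport {L} isMin h≢0 h∈L = conclude (axes-or-1 congr d∣p-2 (All.tabulate λ g∈L → g∈L))
        where
        congr : AtomsCongruent (_∈ L) d
        congr = minΔ⇒congruent isMin
        d∣p-2 : d ℕ.∣ p Nat.∸ 2
        d∣p-2 = congruent⇒∣p-2 val congr h≢0 h∈L
        conclude : AxisDecomposition (_∈ L) L ⊎ d ≡ 1 → Goal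
        conclude (inj₂ d≡1)  = Vec.tabulate (λ _ → 1) , VecAll.tabulate⁺ (λ _ → 1∈Δ*₁) , trans (ones 1≤r) (sym d≡1)
        conclude (inj₁ axes) = ds , ds∈Δ* , ℕ.∣-antisym gcd∣d d∣gcd
          where open Components isMin h≢0 h∈L d∣p-2 axes

    unit : Fin r → Group
    unit i = Vec.tabulate λ j → residue p (δ i j)

    unit-independent : Independent p (λ i → val (unit i))
    unit-independent c p∣ k = ∣-resp-- (subst (λ w → + p ∣ w - ∑ (λ i → c i * val (unit i) k)) (∑-δ c k) rows) (p∣ k)
      where
      eq : ∀ c d v → c * d ≡ c * - (v - d) + c * v
      eq = solve-∀
      cancel : ∀ a b → a ≡ a + b - b
      cancel = solve-∀
      rows : + p ∣ ∑ (λ i → c i * δ i k) - ∑ (λ i → c i * val (unit i) k)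
      rows = subst (+ p ∣_)
        (trans (cancel (∑ λ i → c i * - (val (unit i) k - δ i k)) (∑ λ i → c i * val (unit i) k))
          (cong (_- ∑ (λ i → c i * val (unit i) k)) (sym (trans (sum-cong-≗ λ i → eq (c i) (δ i k) (val (unit i) k))
            (∑-distrib-+ (λ i → c i * - (val (unit i) k - δ i k)) (λ i → c i * val (unit i) k))))))
        (∣-∑ λ i → ∣n⇒∣m*n (c i) (∣m⇒∣-m (subst (λ x → + p ∣ + toℕ x - δ i k)
          (sym (Vec.lookup∘tabulate (λ j → residue p (δ i j)) k)) (residue-cong p (δ i k)))))

    -- The supports belonging to the r given distances are placed on the r coordinate axes. Each
    -- distance stays a length difference in the union, hence so does the gcd, which divides p - 2
    -- and is therefore odd and positive.
    Δ*-backward : 1 ≤ r → ∀ {ds} → All (Seqs.InΔ* (B±Cp p)) ds → Seqs.InΔ* (B±Cpr p r) (gcdVec ds)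
    Δ*-backward 1≤r {ds} ds∈Δ* =
      Over Q , divClosed-resp Cpr.zeroSum⇒B± Cpr.B±⇒zeroSum (over-divClosed Q) ,
      congruent⇒minΔ 0<gcd (∣p-2⇒⊥2 gcd∣p-2) (gcdVec-diff ds λ j → U.component-diff j (C₁.Over.minΔ-diff (_∈ L j) (isMin j)))
        (U.union-congruent λ j atom q → ℕ.∣-trans (gcdVec∣lookup ds j) (C₁.minΔ⇒congruent (isMin j) atom q))
      where
      support : ∀ j → Σ (List (Fin p)) λ L → IsMinΔ₁ (_∈ L) (lookup ds j)
      support j = let S , divClosed , isMin = VecAll.lookup⁺ ds∈Δ* j in
        C₁.restrict-to-support (divClosed-resp Cp.B±⇒zeroSum Cp.zeroSum⇒B± divClosed) isMin
      L : Fin r → List (Fin p)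
      L j = proj₁ (support j)
      isMin : ∀ j → IsMinΔ₁ (_∈ L j) (lookup ds j)
      isMin j = proj₂ (support j)
      Q : Group → Set
      Q h = Σ (Fin r) λ j → Σ (Fin p) λ a → a ∈ L j × h ≡ a · unit j
      module U = Union unit unit-independent {Q} {λ j → _∈ L j} (λ a∈L → _ , _ , a∈L , refl) inj₂
      gcdVec-diff : ∀ {r} (ds : Vec ℕ r) → (∀ j → Over.LengthDiff Q (lookup ds j)) → Over.LengthDiff Q (gcdVec ds)
      gcdVec-diff []       _    = Over.diff-0 Q
      gcdVec-diff (d ∷ ds) diff = Over.diff-gcd Q (diff zero) (gcdVec-diff ds (diff ∘ suc))
      j₀ : Fin r
      j₀ = fromℕ< 1≤r
      gcd∣p-2 : gcdVec ds ℕ.∣ p Nat.∸ 2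
      gcd∣p-2 = let a , a≢0 , a∈L = nonzero-in-support (ZeroSums.zeroSums p val₁) (isMin j₀) in
        ℕ.∣-trans (gcdVec∣lookup ds j₀) (congruent⇒∣p-2 val₁ (C₁.minΔ⇒congruent (isMin j₀)) a≢0 a∈L)
      0<gcd : 0 < gcdVec ds
      0<gcd = ∣p-2⇒>0 gcd∣p-2

theorem4p14 : (p : ℕ) .{{_ : NonZero p}} → Prime p → p ≢ 2 → (r : ℕ) → 1 ≤ r →
    (d : ℕ) →
    (Seqs.InΔ* (B±Cpr p r) d →
    Σ (Vec ℕ r) λ ds → All (Seqs.InΔ* (B±Cp p)) ds × gcdVec ds ≡ d)
    × ((Σ (Vec ℕ r) λ ds → All (Seqs.InΔ* (B±Cp p)) ds × gcdVec ds ≡ d) →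
    Seqs.InΔ* (B±Cpr p r) d)
theorem4p14 p p-prime p≢2 r 1≤r d =
  Δ*-forward r 1≤r ,
  λ { (ds , ds∈Δ* , refl) → Δ*-backward r 1≤r ds∈Δ* }
  where open OddPrimeΔ p p-prime p≢2
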